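{- For every integer $n\geq 0$, the polynomial $J_{2n+1}(x)$ is $\gamma$-positive. Thus $J_{2n+1}(x)$ is symmetric and unimodal.
   Context: For $k\in(0,1)$ let $\mathrm{sn}(u,k)$ be the Jacobian elliptic function, i.e. $x=\mathrm{sn}(u,k)$ is the inverse of the elliptic integral of the first kind $u=\int_0^x\frac{dt}{\sqrt{(1-t^2)(1-k^2t^2)}}$. The polynomials $J_{2n+1}(x)$ are defined by the Taylor expansion $\mathrm{sn}(u,k)=\sum_{n\geq 0}(-1)^nJ_{2n+1}(k^2)\frac{u^{2n+1}}{(2n+1)!}$; one has $\deg J_{2n+1}(x)=n$. For example $J_1(x)=1$, $J_3(x)=1+x$, $J_5(x)=1+14x+x^2$, $J_7(x)=1+135x+135x^2+x^3$. Let $f(x)=\sum_{i=0}^m f_ix^i\in\mathbb{R}[x]$ have degree $m$. It is unimodal if there is an index $r$ with $f_0\leq f_1\leq\cdots\leq f_r\geq f_{r+1}\geq\cdots\geq f_m$. It is symmetric if $f_i=f_{m-i}$ for $0\leq i\leq m$. A symmetric $f$ can be uniquely expanded as $f(x)=\sum_{k=0}^{\lfloor m/2\rfloor}\gamma_kx^k(1+x)^{m-2k}$, and $f$ is called $\gamma$-positive if it is symmetric and $\gamma_k\geq 0$ for all $0\leq k\leq\lfloor m/2\rfloor$. -}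

module Defs where

open import Algebra.Bundles using (CommutativeRing; RawRing)
open import Algebra.Morphism.Structures using (module RingMorphisms)
import Algebra.Morphism.RingMonomorphism as RingMonomorphism
import Algebra.Properties.Ring as RingProperties
import Algebra.Properties.Semiring.Exp as Exp
import Algebra.Properties.Semiring.Sum as Sum
open import Data.Fin.Base using (Fin; toℕ)
open import Data.Integer.Base as ℤ using (ℤ; +_)
open import Data.List.Base using (List; []; _∷_; map)
open import Data.Nat.Base as ℕ using (ℕ; zero; suc; _∸_; ⌊_/2⌋; _!; z≤n; s≤s)
import Data.Nat.Properties as ℕ
open import Data.Product.Base using (Σ; _×_; _,_)
open import Data.Rational.Base as ℚ using (ℚ; 0ℚ; 1ℚ; ½)
import Data.Rational.Properties as ℚ
open import Data.Sum.Base using (inj₁; inj₂)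
open import Level using (0ℓ)
open import Relation.Binary.PropositionalEquality as ≡ using (_≡_; _≢_; refl)
import Relation.Binary.Reasoning.Setoid as SetoidReasoning

------------------------------------------------------------------------
-- Formal power series over a commutative ring

module Series {c ℓ} (R : CommutativeRing c ℓ) where

  open CommutativeRing R renaming (refl to ≈-refl; sym to ≈-sym; trans to ≈-trans)
  open RingProperties ring using (-0#≈0#)
  open SetoidReasoning setoid

  Series : Set c
  Series = ℕ → Carrier

  infix  4 _≋_
  infixl 6 _⊕_
  infixl 7 _⊛_
  infix  8 ⊖_
  infixr 9 _⊚_

  _≋_ : Series → Series → Set ℓ
  f ≋ g = ∀ n → f n ≈ g n

  tail : Series → Series
  tail f n = f (suc n)

  -- Multiplication by the variable.
  shift : Series → Series
  shift f zero    = 0#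
  shift f (suc n) = f n

  const : Carrier → Series
  const a zero    = a
  const a (suc n) = 0#

  var : Series
  var = shift (const 1#)

  _⊕_ : Series → Series → Series
  (f ⊕ g) n = f n + g n

  ⊖_ : Series → Series
  (⊖ f) n = - f n

  -- The Cauchy product: (f ⊛ g) n = f 0 * g n + f 1 * g (n - 1) + ⋯ + f n * g 0.
  _⊛_ : Series → Series → Series
  (f ⊛ g) zero    = f 0 * g 0
  (f ⊛ g) (suc n) = f 0 * g (suc n) + (tail f ⊛ g) n

  ⊛-cong : ∀ {f f′ g g′} → f ≋ f′ → g ≋ g′ → f ⊛ g ≋ f′ ⊛ g′
  ⊛-cong p q zero    = *-cong (p 0) (q 0)
  ⊛-cong p q (suc n) =
    +-cong (*-cong (p 0) (q (suc n))) (⊛-cong (λ i → p (suc i)) q n)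

  ⊛-unfoldʳ : ∀ f g n → (f ⊛ g) (suc n) ≈ (f ⊛ tail g) n + f (suc n) * g 0
  ⊛-unfoldʳ f g zero    = ≈-refl
  ⊛-unfoldʳ f g (suc n) =
    ≈-trans (+-congˡ (⊛-unfoldʳ (tail f) g n)) (≈-sym (+-assoc _ _ _))

  ⊛-comm : ∀ f g → f ⊛ g ≋ g ⊛ f
  ⊛-comm f g zero    = *-comm _ _
  ⊛-comm f g (suc n) = begin
    f 0 * g (suc n) + (tail f ⊛ g) n  ≈⟨ +-cong (*-comm _ _) (⊛-comm (tail f) g n) ⟩
    g (suc n) * f 0 + (g ⊛ tail f) n  ≈⟨ +-comm _ _ ⟩
    (g ⊛ tail f) n + g (suc n) * f 0  ≈⟨ ⊛-unfoldʳ g f n ⟨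
    (g ⊛ f) (suc n)                   ∎

  private
    +-swap : ∀ a b x y → (a + b) + (x + y) ≈ (a + x) + (b + y)
    +-swap a b x y = begin
      (a + b) + (x + y)  ≈⟨ +-assoc _ _ _ ⟩
      a + (b + (x + y))  ≈⟨ +-congˡ (+-assoc _ _ _) ⟨
      a + ((b + x) + y)  ≈⟨ +-congˡ (+-congʳ (+-comm _ _)) ⟩
      a + ((x + b) + y)  ≈⟨ +-congˡ (+-assoc _ _ _) ⟩
      a + (x + (b + y))  ≈⟨ +-assoc _ _ _ ⟨
      (a + x) + (b + y)  ∎

  ⊛-distribʳ : ∀ h f g → (f ⊕ g) ⊛ h ≋ (f ⊛ h) ⊕ (g ⊛ h)
  ⊛-distribʳ h f g zero    = distribʳ _ _ _
  ⊛-distribʳ h f g (suc n) =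
    ≈-trans (+-cong (distribʳ _ _ _) (⊛-distribʳ h (tail f) (tail g) n)) (+-swap _ _ _ _)

  ⊛-distribˡ : ∀ h f g → h ⊛ (f ⊕ g) ≋ (h ⊛ f) ⊕ (h ⊛ g)
  ⊛-distribˡ h f g zero    = distribˡ _ _ _
  ⊛-distribˡ h f g (suc n) =
    ≈-trans (+-cong (distribˡ _ _ _) (⊛-distribˡ (tail h) f g n)) (+-swap _ _ _ _)

  ⊛-scaleˡ : ∀ a f g n → ((λ i → a * f i) ⊛ g) n ≈ a * (f ⊛ g) n
  ⊛-scaleˡ a f g zero    = *-assoc _ _ _
  ⊛-scaleˡ a f g (suc n) =
    ≈-trans (+-cong (*-assoc _ _ _) (⊛-scaleˡ a (tail f) g n)) (≈-sym (distribˡ _ _ _))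

  ⊛-assoc : ∀ f g h → (f ⊛ g) ⊛ h ≋ f ⊛ (g ⊛ h)
  ⊛-assoc f g h zero    = *-assoc _ _ _
  ⊛-assoc f g h (suc n) = begin
    (f 0 * g 0) * h (suc n) + (((λ i → f 0 * g (suc i)) ⊕ (tail f ⊛ g)) ⊛ h) n
      ≈⟨ +-cong (*-assoc _ _ _) (⊛-distribʳ h _ _ n) ⟩
    f 0 * (g 0 * h (suc n)) + (((λ i → f 0 * g (suc i)) ⊛ h) n + ((tail f ⊛ g) ⊛ h) n)
      ≈⟨ +-congˡ (+-cong (⊛-scaleˡ (f 0) (tail g) h n) (⊛-assoc (tail f) g h n)) ⟩
    f 0 * (g 0 * h (suc n)) + (f 0 * (tail g ⊛ h) n + (tail f ⊛ (g ⊛ h)) n)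
      ≈⟨ +-assoc _ _ _ ⟨
    f 0 * (g 0 * h (suc n)) + f 0 * (tail g ⊛ h) n + (tail f ⊛ (g ⊛ h)) n
      ≈⟨ +-congʳ (distribˡ _ _ _) ⟨
    f 0 * (g ⊛ h) (suc n) + (tail f ⊛ (g ⊛ h)) n ∎

  ⊛-zeroˡ : ∀ f n → ((λ _ → 0#) ⊛ f) n ≈ 0#
  ⊛-zeroˡ f zero    = zeroˡ _
  ⊛-zeroˡ f (suc n) = ≈-trans (+-cong (zeroˡ _) (⊛-zeroˡ f n)) (+-identityˡ _)

  ⊛-constˡ : ∀ a f n → (const a ⊛ f) n ≈ a * f n
  ⊛-constˡ a f zero    = ≈-refl
  ⊛-constˡ a f (suc n) = ≈-trans (+-congˡ (⊛-zeroˡ f n)) (+-identityʳ _)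

  ⊛-identityˡ : ∀ f → const 1# ⊛ f ≋ f
  ⊛-identityˡ f n = ≈-trans (⊛-constˡ 1# f n) (*-identityˡ _)

  commutativeRing : CommutativeRing c ℓ
  commutativeRing = record
    { Carrier = Series
    ; _≈_ = _≋_
    ; _+_ = _⊕_
    ; _*_ = _⊛_
    ; -_  = ⊖_
    ; 0#  = λ _ → 0#
    ; 1#  = const 1#
    ; isCommutativeRing = record
      { isRing = record
        { +-isAbelianGroup = record
          { isGroup = record
            { isMonoid = record
              { isSemigroup = record
                { isMagma = record
                  { isEquivalence = record
                    { refl  = λ _ → ≈-refl
                    ; sym   = λ p n → ≈-sym (p n)
                    ; trans = λ p q n → ≈-trans (p n) (q n)
                    }
                  ; ∙-cong = λ p q n → +-cong (p n) (q n)
                  }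
                ; assoc = λ _ _ _ _ → +-assoc _ _ _
                }
              ; identity = (λ _ _ → +-identityˡ _) , (λ _ _ → +-identityʳ _)
              }
            ; inverse = (λ _ _ → -‿inverseˡ _) , (λ _ _ → -‿inverseʳ _)
            ; ⁻¹-cong = λ p n → -‿cong (p n)
            }
          ; comm = λ _ _ _ → +-comm _ _
          }
        ; *-cong = ⊛-cong
        ; *-assoc = ⊛-assoc
        ; *-identity = ⊛-identityˡ , λ f n → ≈-trans (⊛-comm f _ n) (⊛-identityˡ f n)
        ; distrib = ⊛-distribˡ , ⊛-distribʳ
        }
      ; *-comm = ⊛-comm
      }
    }

  -- Composition f(g(t)), meaningful when g 0 ≈ 0#: the term f m * gᵐ then has
  -- no coefficient below degree m, so the coefficient of degree n only involves
  -- f 0, …, f n.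
  horner : ℕ → Series → Series → Series
  horner zero    f g = λ _ → 0#
  horner (suc N) f g = const (f 0) ⊕ (g ⊛ horner N (tail f) g)

  _⊚_ : Series → Series → Series
  (f ⊚ g) n = horner (suc n) f g n

  Agree : ℕ → Series → Series → Set ℓ
  Agree n f g = ∀ i → i ℕ.< n → f i ≈ g i

  ⊛-agree : ∀ {n f f′ g g′} → Agree n f f′ → Agree n g g′ → Agree n (f ⊛ g) (f′ ⊛ g′)
  ⊛-agree p q zero    i<n = *-cong (p 0 i<n) (q 0 i<n)
  ⊛-agree p q (suc i) (s≤s i<n) =
    +-cong (*-cong (p 0 (s≤s z≤n)) (q (suc i) (s≤s i<n)))
           (⊛-agree (λ j j<n → p (suc j) (s≤s j<n))
                    (λ j j<n → q j (ℕ.m<n⇒m<1+n j<n)) i i<n)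

  shift-agree : ∀ {n f g} → Agree n f g → Agree (suc n) (shift f) (shift g)
  shift-agree p zero    _         = ≈-refl
  shift-agree p (suc i) (s≤s i<n) = p i i<n

  ⊛-vanish-agree : ∀ {n s g h} → s 0 ≈ 0# → Agree n g h → Agree (suc n) (s ⊛ g) (s ⊛ h)
  ⊛-vanish-agree {s = s} {g} {h} s0 p zero _ = begin
    s 0 * g 0  ≈⟨ *-congʳ s0 ⟩
    0# * g 0   ≈⟨ zeroˡ _ ⟩
    0#         ≈⟨ zeroˡ _ ⟨
    0# * h 0   ≈⟨ *-congʳ s0 ⟨
    s 0 * h 0  ∎
  ⊛-vanish-agree {s = s} {g} {h} s0 p (suc i) (s≤s i<n) = begin
    s 0 * g (suc i) + (tail s ⊛ g) i
      ≈⟨ +-cong (≈-trans (*-congʳ s0) (≈-trans (zeroˡ _) (≈-trans (≈-sym (zeroˡ _)) (*-congʳ (≈-sym s0)))))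
                (⊛-agree {suc i} (λ _ _ → ≈-refl) (λ j j≤i → p j (ℕ.≤-trans j≤i i<n)) i ℕ.≤-refl) ⟩
    s 0 * h (suc i) + (tail s ⊛ h) i  ∎

  horner-agree : ∀ {n} N f {g g′} → Agree n g g′ → Agree n (horner N f g) (horner N f g′)
  horner-agree zero    f p i _   = ≈-refl
  horner-agree (suc N) f p i i<n =
    +-congˡ (⊛-agree p (horner-agree N (tail f) p) i i<n)

  horner-step : ∀ N f {g} → g 0 ≈ 0# → Agree N (horner N f g) (horner (suc N) f g)
  horner-step (suc N) f g0 i i<N =
    +-congˡ (⊛-vanish-agree g0 (horner-step N (tail f) g0) i i<N)

  horner-stable : ∀ N f {g} → g 0 ≈ 0# → Agree N (horner N f g) (f ⊚ g)
  horner-stable (suc N) f g0 i (s≤s i≤N) with ℕ.m≤n⇒m<n∨m≡n i≤N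
  ... | inj₁ i<N  =
    ≈-trans (≈-sym (horner-step N f g0 i i<N)) (horner-stable N f g0 i i<N)
  ... | inj₂ refl = ≈-refl

  ⊚-unfold : ∀ f {g} → g 0 ≈ 0# → f ⊚ g ≋ const (f 0) ⊕ (g ⊛ (tail f ⊚ g))
  ⊚-unfold f g0 n =
    +-congˡ (⊛-vanish-agree g0 (horner-stable n (tail f) g0) n ℕ.≤-refl)

  -- The solution of v = Φ v for an operator Φ whose n-th output coefficient
  -- only depends on the input coefficients of degree < n.
  approx : (Series → Series) → ℕ → Series
  approx Φ zero    = λ _ → 0#
  approx Φ (suc k) = Φ (approx Φ k)

  solve : (Series → Series) → Series
  solve Φ n = approx Φ (suc n) n

  Contractive : (Series → Series) → Set _
  Contractive Φ = ∀ n {f g} → Agree n f g → Agree (suc n) (Φ f) (Φ g)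

  solve-spec : ∀ Φ → Contractive Φ → solve Φ ≋ Φ (solve Φ)
  solve-spec Φ con n = con n (stable n) n ℕ.≤-refl
    where
    step : ∀ k → Agree k (approx Φ k) (approx Φ (suc k))
    step (suc k) = con k (step k)

    stable : ∀ k → Agree k (approx Φ k) (solve Φ)
    stable (suc k) i (s≤s i≤k) with ℕ.m≤n⇒m<n∨m≡n i≤k
    ... | inj₁ i<k  = ≈-trans (≈-sym (step k i i<k)) (stable k i i<k)
    ... | inj₂ refl = ≈-refl

  -- 1/f for f 0 ≈ 1#: with f = 1 + t f₁, solve r = 1 - t f₁ r.
  recip : Series → Series
  recip f = solve (λ r → const 1# ⊕ ⊖ shift (tail f ⊛ r))

  -- √f for f 0 ≈ 1#: with f = 1 + t f₁, the series 1 + t v is a square root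
  -- exactly when 2 v = f₁ - t v².  The first argument is the scalar 1/2.
  sqrt : Carrier → Series → Series
  sqrt half f = const 1# ⊕ shift (solve (λ v → const half ⊛ (tail f ⊕ ⊖ shift (v ⊛ v))))

  -- The compositional inverse of f, for f 0 ≈ 0# and f 1 ≈ 1#: with f = t φ(t),
  -- the series s = t v satisfies f(s) = t exactly when v = 1/φ(t v).
  inverse : Series → Series
  inverse f = shift (solve (λ v → recip (tail f ⊚ shift v)))

  recip-contractive : ∀ f → Contractive (λ r → const 1# ⊕ ⊖ shift (tail f ⊛ r))
  recip-contractive f n p i i<n =
    +-congˡ (-‿cong (shift-agree (⊛-agree (λ _ _ → ≈-refl) p) i i<n))

  recip-spec : ∀ f → f 0 ≈ 1# → f ⊛ recip f ≋ const 1#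
  recip-spec f f0 zero = begin
    f 0 * (1# + - 0#)  ≈⟨ *-cong f0 (≈-trans (+-congˡ -0#≈0#) (+-identityʳ _)) ⟩
    1# * 1#            ≈⟨ *-identityˡ _ ⟩
    1#                 ∎
  recip-spec f f0 (suc n) = begin
    f 0 * recip f (suc n) + (tail f ⊛ recip f) n
      ≈⟨ +-congʳ (≈-trans (*-congʳ f0) (*-identityˡ _)) ⟩
    recip f (suc n) + (tail f ⊛ recip f) n
      ≈⟨ +-congʳ (solve-spec _ (recip-contractive f) (suc n)) ⟩
    (0# + - (tail f ⊛ recip f) n) + (tail f ⊛ recip f) n
      ≈⟨ +-congʳ (+-identityˡ _) ⟩
    - (tail f ⊛ recip f) n + (tail f ⊛ recip f) n
      ≈⟨ -‿inverseˡ _ ⟩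
    0# ∎

  recip-agree : ∀ {n f g} → Agree n f g → Agree n (recip f) (recip g)
  recip-agree {n} {f} {g} p i = go (suc i) i
    where
    go : ∀ k → Agree n (approx (λ r → const 1# ⊕ ⊖ shift (tail f ⊛ r)) k)
                       (approx (λ r → const 1# ⊕ ⊖ shift (tail g ⊛ r)) k)
    go zero    i       _         = ≈-refl
    go (suc k) zero    _         = ≈-refl
    go (suc k) (suc i) i<n =
      +-congˡ (-‿cong (⊛-agree {suc i}
        (λ j j≤i → p (suc j) (ℕ.≤-trans (s≤s j≤i) i<n))
        (λ j j≤i → go k j (ℕ.≤-trans j≤i (ℕ.<⇒≤ i<n))) i ℕ.≤-refl))

  sqrt-spec : ∀ half f → half + half ≈ 1# → f 0 ≈ 1# → sqrt half f ⊛ sqrt half f ≋ f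
  sqrt-spec half f hh f0 zero = begin
    (1# + 0#) * (1# + 0#)  ≈⟨ *-cong (+-identityʳ _) (+-identityʳ _) ⟩
    1# * 1#                ≈⟨ *-identityˡ _ ⟩
    1#                     ≈⟨ f0 ⟨
    f 0                    ∎
  sqrt-spec half f hh f0 (suc n) = begin
    (1# + 0#) * (0# + v n) + ((λ i → 0# + v i) ⊛ (const 1# ⊕ shift v)) n
      ≈⟨ +-cong (≈-trans (*-cong (+-identityʳ _) (+-identityˡ _)) (*-identityˡ _))
                (⊛-cong (λ _ → +-identityˡ _) (λ _ → ≈-refl) n) ⟩
    v n + (v ⊛ (const 1# ⊕ shift v)) n
      ≈⟨ +-congˡ (≈-trans (⊛-distribˡ v _ _ n)
           (+-cong (≈-trans (⊛-comm v _ n) (⊛-identityˡ v n)) (v-shift n))) ⟩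
    v n + (v n + shift (v ⊛ v) n)
      ≈⟨ +-assoc _ _ _ ⟨
    (v n + v n) + shift (v ⊛ v) n
      ≈⟨ +-congʳ (+-cong (v-eq n) (v-eq n)) ⟩
    (half * d + half * d) + shift (v ⊛ v) n
      ≈⟨ +-congʳ (≈-trans (≈-sym (distribʳ _ _ _)) (≈-trans (*-congʳ hh) (*-identityˡ _))) ⟩
    (f (suc n) + - shift (v ⊛ v) n) + shift (v ⊛ v) n
      ≈⟨ +-assoc _ _ _ ⟩
    f (suc n) + (- shift (v ⊛ v) n + shift (v ⊛ v) n)
      ≈⟨ ≈-trans (+-congˡ (-‿inverseˡ _)) (+-identityʳ _) ⟩
    f (suc n) ∎
    where
    Φ : Series → Series
    Φ v = const half ⊛ (tail f ⊕ ⊖ shift (v ⊛ v))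

    v : Series
    v = solve Φ

    d : Carrier
    d = f (suc n) + - shift (v ⊛ v) n

    contractive : Contractive Φ
    contractive n p = ⊛-agree (λ _ _ → ≈-refl)
      (λ i i<n → +-congˡ (-‿cong (shift-agree (⊛-agree p p) i i<n)))

    v-eq : ∀ n → v n ≈ half * (f (suc n) + - shift (v ⊛ v) n)
    v-eq n = ≈-trans (solve-spec Φ contractive n) (⊛-constˡ half _ n)

    v-shift : ∀ n → (v ⊛ shift v) n ≈ shift (v ⊛ v) n
    v-shift zero    = zeroʳ _
    v-shift (suc n) = ≈-trans (⊛-comm v (shift v) (suc n)) (≈-trans (+-congʳ (zeroˡ _)) (+-identityˡ _))

  inverse-spec : ∀ f → f 0 ≈ 0# → f 1 ≈ 1# → f ⊚ inverse f ≋ var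
  inverse-spec f f0 f1 n = ≈-trans (⊚-unfold f ≈-refl n) (go n)
    where
    Φ : Series → Series
    Φ v = recip (tail f ⊚ shift v)

    v : Series
    v = solve Φ

    w : Series
    w = tail f ⊚ shift v

    contractive : Contractive Φ
    contractive n p =
      recip-agree (λ i i<n → horner-agree (suc i) (tail f) (shift-agree p) i i<n)

    w0 : w 0 ≈ 1#
    w0 = begin
      f 1 + 0# * 0#  ≈⟨ +-cong f1 (zeroˡ _) ⟩
      1# + 0#        ≈⟨ +-identityʳ _ ⟩
      1#             ∎

    go : ∀ n → (const (f 0) ⊕ (shift v ⊛ w)) n ≈ var n
    go zero    = ≈-trans (+-cong f0 (zeroˡ _)) (+-identityʳ _)
    go (suc n) = begin
      0# + (0# * w (suc n) + (v ⊛ w) n)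
        ≈⟨ ≈-trans (+-identityˡ _) (≈-trans (+-congʳ (zeroˡ _)) (+-identityˡ _)) ⟩
      (v ⊛ w) n
        ≈⟨ ⊛-cong (solve-spec Φ contractive) (λ _ → ≈-refl) n ⟩
      (recip w ⊛ w) n
        ≈⟨ ≈-trans (⊛-comm _ w n) (recip-spec w w0 n) ⟩
      const 1# n ∎

------------------------------------------------------------------------
-- Polynomials with rational coefficients

-- Coefficients are listed from degree 0 upwards; trailing zeros are allowed,
-- so equality is equality of coefficients.
Poly : Set
Poly = List ℚ

coeff : Poly → ℕ → ℚ
coeff []      _       = 0ℚ
coeff (a ∷ p) zero    = a
coeff (a ∷ p) (suc n) = coeff p n

module ℚ⟦x⟧ = Series ℚ.+-*-commutativeRing

infix 4 _≈ₚ_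

_≈ₚ_ : Poly → Poly → Set
p ≈ₚ q = ∀ n → coeff p n ≡ coeff q n

constₚ : ℚ → Poly
constₚ a = a ∷ []

xₚ : Poly
xₚ = 0ℚ ∷ 1ℚ ∷ []

private
  addₚ : Poly → Poly → Poly
  addₚ []      q       = q
  addₚ (a ∷ p) []      = a ∷ p
  addₚ (a ∷ p) (b ∷ q) = (a ℚ.+ b) ∷ addₚ p q

  mulₚ : Poly → Poly → Poly
  mulₚ []      q = []
  mulₚ (a ∷ p) q = addₚ (map (a ℚ.*_) q) (0ℚ ∷ mulₚ p q)

  coeff-add : ∀ p q n → coeff (addₚ p q) n ≡ coeff p n ℚ.+ coeff q n
  coeff-add []      q       n       = ≡.sym (ℚ.+-identityˡ _)
  coeff-add (a ∷ p) []      n       = ≡.sym (ℚ.+-identityʳ _)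
  coeff-add (a ∷ p) (b ∷ q) zero    = refl
  coeff-add (a ∷ p) (b ∷ q) (suc n) = coeff-add p q n

  coeff-scale : ∀ a q n → coeff (map (a ℚ.*_) q) n ≡ a ℚ.* coeff q n
  coeff-scale a []      n       = ≡.sym (ℚ.*-zeroʳ a)
  coeff-scale a (b ∷ q) zero    = refl
  coeff-scale a (b ∷ q) (suc n) = coeff-scale a q n

  coeff-neg : ∀ q n → coeff (map (ℚ.-_) q) n ≡ ℚ.- coeff q n
  coeff-neg []      n       = refl
  coeff-neg (b ∷ q) zero    = refl
  coeff-neg (b ∷ q) (suc n) = coeff-neg q n

  coeff-mul : ∀ p q n → coeff (mulₚ p q) n ≡ (coeff p ℚ⟦x⟧.⊛ coeff q) n
  coeff-mul []      q n       = ≡.sym (ℚ⟦x⟧.⊛-zeroˡ (coeff q) n)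
  coeff-mul (a ∷ p) q zero    = ≡.trans (coeff-add (map (a ℚ.*_) q) _ 0)
    (≡.trans (≡.cong (ℚ._+ 0ℚ) (coeff-scale a q 0)) (ℚ.+-identityʳ _))
  coeff-mul (a ∷ p) q (suc n) = ≡.trans (coeff-add (map (a ℚ.*_) q) _ (suc n))
    (≡.cong₂ ℚ._+_ (coeff-scale a q (suc n)) (coeff-mul p q n))

  rawRing : RawRing 0ℓ 0ℓ
  rawRing = record
    { Carrier = Poly ; _≈_ = _≈ₚ_ ; _+_ = addₚ ; _*_ = mulₚ ; -_ = map (ℚ.-_)
    ; 0# = [] ; 1# = constₚ 1ℚ }

  module ⟦x⟧ = CommutativeRing ℚ⟦x⟧.commutativeRing

  open RingMorphisms rawRing ⟦x⟧.rawRing using (IsRingMonomorphism)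

  coeff-monomorphism : IsRingMonomorphism coeff
  coeff-monomorphism = record
    { isRingHomomorphism = record
      { isSemiringHomomorphism = record
        { isNearSemiringHomomorphism = record
          { +-isMonoidHomomorphism = record
            { isMagmaHomomorphism = record
              { isRelHomomorphism = record { cong = λ p → p }
              ; homo = coeff-add
              }
            ; ε-homo = λ _ → refl
            }
          ; *-homo = coeff-mul
          }
        ; 1#-homo = λ { zero → refl ; (suc n) → refl }
        }
      ; -‿homo = coeff-neg
      }
    ; injective = λ p → p
    }

ℚ[x] : CommutativeRing 0ℓ 0ℓ
ℚ[x] = record
  { isCommutativeRing =
      RingMonomorphism.isCommutativeRing coeff-monomorphism ⟦x⟧.isCommutativeRing }

open CommutativeRing ℚ[x] public
  using () renaming (_+_ to _+ₚ_; _*_ to _*ₚ_; -_ to -ₚ_; 1# to 1ₚ)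
open Exp (CommutativeRing.semiring ℚ[x]) public using () renaming (_^_ to _^ₚ_)
open Sum (CommutativeRing.semiring ℚ[x]) public using () renaming (sum to sumₚ)

-- f has degree m.
HasDegree : ℕ → Poly → Set
HasDegree m f = coeff f m ≢ 0ℚ × (∀ i → m ℕ.< i → coeff f i ≡ 0ℚ)

-- In the three predicates below, m stands for the degree of f.

Unimodal : ℕ → Poly → Set
Unimodal m f = Σ ℕ λ r → r ℕ.≤ m
  × (∀ i → i ℕ.< r → coeff f i ℚ.≤ coeff f (suc i))
  × (∀ i → r ℕ.≤ i → i ℕ.< m → coeff f (suc i) ℚ.≤ coeff f i)

Symmetric : ℕ → Poly → Set
Symmetric m f = ∀ i → i ℕ.≤ m → coeff f i ≡ coeff f (m ∸ i)

GammaPositive : ℕ → Poly → Set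
GammaPositive m f = Symmetric m f × Σ (Fin (suc ⌊ m /2⌋) → ℚ) λ γ →
    (f ≈ₚ sumₚ λ k → constₚ (γ k) *ₚ xₚ ^ₚ toℕ k *ₚ (1ₚ +ₚ xₚ) ^ₚ (m ∸ 2 ℕ.* toℕ k))
  × (∀ k → 0ℚ ℚ.≤ γ k)

------------------------------------------------------------------------
-- The Jacobian elliptic function sn

-- Taylor series at 0, as formal power series whose coefficients are polynomials
-- in x = k².
open Series ℚ[x] public

-- (1 - t²)(1 - x t²)
radicand : Series
radicand = (const 1ₚ ⊕ ⊖ (var ⊛ var)) ⊛ (const 1ₚ ⊕ ⊖ (const xₚ ⊛ (var ⊛ var)))

integrand : Series
integrand = recip (sqrt (constₚ ½) radicand)

-- ∫₀ᵗ f
∫ : Series → Series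
∫ f zero    = []
∫ f (suc n) = constₚ (+ 1 ℚ./ suc n) *ₚ f n

ellipticIntegral : Series
ellipticIntegral = ∫ integrand

sn : Series
sn = inverse ellipticIntegral

sqrt-radicand-spec : sqrt (constₚ ½) radicand ⊛ sqrt (constₚ ½) radicand ≋ radicand
sqrt-radicand-spec = sqrt-spec (constₚ ½) radicand
  (λ { zero → refl ; (suc _) → refl })
  (λ { zero → refl ; (suc zero) → refl ; (suc (suc _)) → refl })

integrand-spec : sqrt (constₚ ½) radicand ⊛ integrand ≋ const 1ₚ
integrand-spec = recip-spec (sqrt (constₚ ½) radicand)
  (λ { zero → refl ; (suc _) → refl })

sn-spec : ellipticIntegral ⊚ sn ≋ var
sn-spec = inverse-spec ellipticIntegral
  (λ _ → refl) (λ { zero → refl ; (suc zero) → refl ; (suc (suc _)) → refl })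

-- J n is the polynomial J₂ₙ₊₁, where sn = Σₙ (-1)ⁿ J₂ₙ₊₁ u²ⁿ⁺¹ / (2n+1)!.
J : ℕ → Poly
J n = constₚ (((ℤ.-1ℤ ℤ.^ n) ℤ.* (+ ((1 ℕ.+ 2 ℕ.* n) !))) ℚ./ 1) *ₚ sn (1 ℕ.+ 2 ℕ.* n)

{-# OPTIONS --safe #-}
-- Since sn inverts the integral of 1/√((1-t²)(1-xt²)), the chain rule gives
-- sn′² = (1-sn²)(1-x sn²), and differentiating once more sn″ = -(1+x) sn + 2x sn³.
-- Up to the signs (-1)ⁿ, each step of the resulting recurrence for the coefficients of sn
-- multiplies by 1+x, or multiplies three earlier coefficients together and by 2x, so
-- J₂ₙ₊₁ is a nonnegative combination of the monomials xᵏ(1+x)ⁿ⁻²ᵏ.  Each of these is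
-- symmetric about n/2 and increasing up to there.  The constant term (hence, by symmetry,
-- the leading coefficient) does not vanish because the recurrence at x = 0 is that of sin.
module Submission where

import Algebra.Apartness.Properties.HeytingCommutativeRing as HeytingProperties
open import Algebra.Bundles using (CommutativeRing)
open import Algebra.Morphism.Structures using (module RingMorphisms)
import Algebra.Properties.CommutativeMonoid.Mult as AdditiveMult
import Algebra.Properties.CommutativeMonoid.Sum as AdditiveSum
import Algebra.Properties.Ring as RingProperties
import Algebra.Properties.Semiring.Exp as Exp
import Algebra.Properties.Semiring.Mult as Mult
import Algebra.Solver.Ring.NaturalCoefficients.Default as SemiringSolver
open import Data.Fin.Base using (Fin; zero; suc; toℕ; fromℕ<; punchIn)
import Data.Fin.Properties as Fin
import Data.Integer.Base as ℤ
import Data.Integer.Properties as ℤ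
open import Data.Integer.Solver using () renaming (module +-*-Solver to ℤ-Solver)
open import Data.List.Base using ([]; _∷_; map)
open import Data.Nat.Base as ℕ using (ℕ; zero; suc; _∸_; ⌊_/2⌋; _!; z≤n; s≤s)
open import Data.Nat.Induction using (<-rec)
import Data.Nat.Properties as ℕ
open import Data.Nat.Solver using () renaming (module +-*-Solver to ℕ-Solver)
open import Data.Product.Base using (Σ; _×_; _,_)
open import Data.Rational.Base as ℚ using (ℚ; 0ℚ; 1ℚ; ½)
import Data.Rational.Properties as ℚ
import Data.Rational.Unnormalised.Base as ℚᵘ
import Data.Rational.Unnormalised.Properties as ℚᵘ
open import Data.Sum.Base using (inj₁; inj₂)
open import Defs using (module Series)
open import Level using (_⊔_)
open import Relation.Binary.PropositionalEquality as ≡ using (_≡_; _≢_; refl)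
import Relation.Binary.Reasoning.Setoid as SetoidReasoning
open import Relation.Nullary using (yes; no; contradiction)

-- Calculus of formal power series

module SeriesCalculus {c ℓ} (R : CommutativeRing c ℓ) where

  open CommutativeRing R renaming (refl to ≈-refl; sym to ≈-sym; trans to ≈-trans)
  open Series R hiding (solve)
  open Mult semiring using (×-congʳ; ×-comm-*) renaming (_×_ to _·_)
  open AdditiveMult +-commutativeMonoid using (×-distrib-+)
  private
    module S = CommutativeRing commutativeRing
    module SP = RingProperties S.ring
    module RP = RingProperties ring
    module Solver = SemiringSolver S.commutativeSemiring
    module CSolver = SemiringSolver commutativeSemiring
    module ≈R = SetoidReasoning setoid
    module ≋R = SetoidReasoning S.setoid

  agree⇒≋ : ∀ {f g} → (∀ n → Agree n f g) → f ≋ g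
  agree⇒≋ p n = p (suc n) n ℕ.≤-refl

  const-cong : ∀ {a b} → a ≈ b → const a ≋ const b
  const-cong p zero    = p
  const-cong p (suc n) = ≈-refl

  const-+ : ∀ a b → const (a + b) ≋ const a ⊕ const b
  const-+ a b zero    = ≈-refl
  const-+ a b (suc n) = ≈-sym (+-identityˡ 0#)

  const-* : ∀ a b → const (a * b) ≋ const a ⊛ const b
  const-* a b zero    = ≈-refl
  const-* a b (suc n) = ≈-sym (≈-trans (⊛-constˡ a (const b) (suc n)) (zeroʳ a))

  const-0 : const 0# ≋ S.0#
  const-0 zero    = ≈-refl
  const-0 (suc n) = ≈-refl

  -- The formal derivative.

  -- The Euler operator t d/dt. It preserves the degree, so its Leibniz rule can be proved along the
  -- recursion of `_⊛_`; the derivative `D` is `θ` with the index shifted.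
  θ : Series → Series
  θ f n = n · f n

  D : Series → Series
  D f = tail (θ f)

  D-cong : ∀ {f g} → f ≋ g → D f ≋ D g
  D-cong p n = ×-congʳ (suc n) (p (suc n))

  D-⊕ : ∀ f g → D (f ⊕ g) ≋ D f ⊕ D g
  D-⊕ f g n = ×-distrib-+ (f (suc n)) (g (suc n)) (suc n)

  ·-zeroʳ : ∀ n → n · 0# ≈ 0#
  ·-zeroʳ zero    = ≈-refl
  ·-zeroʳ (suc n) = ≈-trans (+-identityˡ _) (·-zeroʳ n)

  D-const : ∀ a → D (const a) ≋ S.0#
  D-const a n = ·-zeroʳ (suc n)

  D-var : D var ≋ S.1#
  D-var zero    = +-identityʳ 1#
  D-var (suc n) = ·-zeroʳ (suc (suc n))

  θ-⊛ : ∀ f g → θ (f ⊛ g) ≋ (θ f ⊛ g) ⊕ (f ⊛ θ g)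
  θ-⊛ f g zero    = ≈-sym (≈-trans (+-cong (zeroˡ _) (zeroʳ _)) (+-identityˡ 0#))
  θ-⊛ f g (suc n) = begin
    suc n · (f 0 * g (suc n) + p)
      ≈⟨ ×-distrib-+ _ _ (suc n) ⟩
    suc n · (f 0 * g (suc n)) + (p + n · p)
      ≈⟨ +-cong (≈-sym (×-comm-* (suc n) _ _)) (+-congˡ (θ-⊛ (tail f) g n)) ⟩
    u + (p + (q + r))
      ≈⟨ CSolver.solve 4 (λ u p q r → (u :+ (p :+ (q :+ r))) := ((p :+ q) :+ (u :+ r))) ≈-refl u p q r ⟩
    (p + q) + (u + r)
      -- `D f` unfolds to `tail f ⊕ θ (tail f)`, because `suc n · a` is `a + n · a`. This is what
      -- absorbs the extra `p`.
      ≈⟨ +-congʳ (⊛-distribʳ g (tail f) (θ (tail f)) n) ⟨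
    (D f ⊛ g) n + (u + r)
      ≈⟨ +-congʳ (≈-trans (+-congʳ (zeroˡ _)) (+-identityˡ _)) ⟨
    (0# * g (suc n) + (D f ⊛ g) n) + (u + r) ∎
    where
    open ≈R
    open CSolver using (_:+_; _:=_)
    p = (tail f ⊛ g) n
    q = (θ (tail f) ⊛ g) n
    r = (tail f ⊛ θ g) n
    u = f 0 * (suc n · g (suc n))

  D-⊛ : ∀ f g → D (f ⊛ g) ≋ (D f ⊛ g) ⊕ (f ⊛ D g)
  D-⊛ f g n = ≈-trans (θ-⊛ f g (suc n)) (+-cong
    (≈-trans (+-congʳ (zeroˡ _)) (+-identityˡ _))
    (≈-trans (⊛-unfoldʳ f (θ g) n) (≈-trans (+-congˡ (zeroʳ _)) (+-identityʳ _))))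

  -- Composition and the chain rule.

  horner-congˡ : ∀ N {f f′} g → f ≋ f′ → horner N f g ≋ horner N f′ g
  horner-congˡ zero    g p = S.refl
  horner-congˡ (suc N) g p =
    S.+-cong (const-cong (p 0)) (S.*-congˡ {g} (horner-congˡ N g (λ i → p (suc i))))

  horner-⊕ : ∀ N f f′ g → horner N (f ⊕ f′) g ≋ horner N f g ⊕ horner N f′ g
  horner-⊕ zero    f f′ g = S.sym (S.+-identityˡ S.0#)
  horner-⊕ (suc N) f f′ g = S.trans
    (S.+-cong (const-+ (f 0) (f′ 0)) (S.*-congˡ {g} (horner-⊕ N (tail f) (tail f′) g)))
    (Solver.solve 5 (λ a b x y z → (a :+ b :+ x :* (y :+ z)) := ((a :+ x :* y) :+ (b :+ x :* z)))
      S.refl (const (f 0)) (const (f′ 0)) g (horner N (tail f) g) (horner N (tail f′) g))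
    where open Solver using (_:+_; _:*_; _:=_)

  horner-scale : ∀ N a f g → horner N (λ i → a * f i) g ≋ const a ⊛ horner N f g
  horner-scale zero    a f g = S.sym (S.zeroʳ (const a))
  horner-scale (suc N) a f g = S.trans
    (S.+-cong (const-* a (f 0)) (S.*-congˡ {g} (horner-scale N a (tail f) g)))
    (Solver.solve 4 (λ a b x y → (a :* b :+ x :* (a :* y)) := (a :* (b :+ x :* y)))
      S.refl (const a) (const (f 0)) g (horner N (tail f) g))
    where open Solver using (_:+_; _:*_; _:=_)

  ⊚-congˡ : ∀ {f f′} g → f ≋ f′ → f ⊚ g ≋ f′ ⊚ g
  ⊚-congˡ g p n = horner-congˡ (suc n) g p n

  ⊚-⊕ : ∀ f f′ g → (f ⊕ f′) ⊚ g ≋ (f ⊚ g) ⊕ (f′ ⊚ g)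
  ⊚-⊕ f f′ g n = horner-⊕ (suc n) f f′ g n

  ⊚-scale : ∀ a f g → (λ i → a * f i) ⊚ g ≋ const a ⊛ (f ⊚ g)
  ⊚-scale a f g n = ≈-trans (horner-scale (suc n) a f g n)
    (≈-trans (⊛-constˡ a (horner (suc n) f g) n) (≈-sym (⊛-constˡ a (f ⊚ g) n)))

  ⊚-const : ∀ a g → const a ⊚ g ≋ const a
  ⊚-const a g n = S.trans (S.+-congˡ {const a} (S.trans (S.*-congˡ {g} (vanish n)) (S.zeroʳ g)))
                          (S.+-identityʳ (const a)) n
    where
    vanish : ∀ N → horner N S.0# g ≋ S.0#
    vanish zero    = S.refl
    vanish (suc N) = S.trans (S.+-cong const-0 (S.trans (S.*-congˡ {g} (vanish N)) (S.zeroʳ g)))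
                             (S.+-identityˡ S.0#)

  module Composition {g : Series} (g0 : g 0 ≈ 0#) where

    ⊚-shift : ∀ f → shift f ⊚ g ≋ g ⊛ (f ⊚ g)
    ⊚-shift f = S.trans (⊚-unfold (shift f) g0)
      (S.trans (S.+-congʳ const-0) (S.+-identityˡ (g ⊛ (f ⊚ g))))

    ⊚-var : var ⊚ g ≋ g
    ⊚-var = S.trans (⊚-shift S.1#) (S.trans (S.*-congˡ {g} (⊚-const 1# g)) (S.*-identityʳ g))

    -- Series offer no structural recursion, so the induction is on the number of coefficients known
    -- to agree. Unfolding puts the factor `g` in front of the claim for `tail f`; since `g` has no
    -- constant term, this gains one coefficient.
    ⊚-⊛ : ∀ f h → (f ⊛ h) ⊚ g ≋ (f ⊚ g) ⊛ (h ⊚ g)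
    ⊚-⊛ f h = agree⇒≋ (λ n → go n f h)
      where
      go : ∀ n f h → Agree n ((f ⊛ h) ⊚ g) ((f ⊚ g) ⊛ (h ⊚ g))
      go (suc n) f h i i<n = begin
        ((f ⊛ h) ⊚ g) i
          ≈⟨ ⊚-unfold (f ⊛ h) g0 i ⟩
        (const (f 0 * h 0) ⊕ g ⊛ (tail (f ⊛ h) ⊚ g)) i
          ≈⟨ +-congˡ (S.*-congˡ {g} (⊚-⊕ (λ j → f 0 * h (suc j)) (tail f ⊛ h) g) i) ⟩
        (const (f 0 * h 0) ⊕ g ⊛ (((λ j → f 0 * h (suc j)) ⊚ g) ⊕ ((tail f ⊛ h) ⊚ g))) i
          ≈⟨ +-congˡ (⊛-vanish-agree g0
               (λ j j<n → +-cong (⊚-scale (f 0) (tail h) g j) (go n (tail f) h j j<n))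
               i i<n) ⟩
        (const (f 0 * h 0) ⊕ g ⊛ ((const (f 0) ⊛ (tail h ⊚ g)) ⊕ ((tail f ⊚ g) ⊛ (h ⊚ g)))) i
          ≈⟨ regroup i ⟩
        ((f ⊚ g) ⊛ (h ⊚ g)) i ∎
        where
        open ≈R
        open Solver using (solve; _:+_; _:*_; _:=_)
        cf = const (f 0)
        ch = const (h 0)
        F = tail f ⊚ g
        H = tail h ⊚ g

        regroup : const (f 0 * h 0) ⊕ g ⊛ ((cf ⊛ H) ⊕ (F ⊛ (h ⊚ g))) ≋ (f ⊚ g) ⊛ (h ⊚ g)
        regroup = S.trans
          (S.+-cong (const-* (f 0) (h 0))
            (S.*-congˡ {g} (S.+-congˡ {cf ⊛ H} (S.*-congˡ {F} (⊚-unfold h g0)))))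
          (S.trans
            (solve 5 (λ cf ch x F H →
                (cf :* ch :+ x :* (cf :* H :+ F :* (ch :+ x :* H)))
                  := ((cf :+ x :* F) :* (ch :+ x :* H)))
              S.refl cf ch g F H)
            (S.sym (S.*-cong (⊚-unfold f g0) (⊚-unfold h g0))))

    -- The same induction on precision, applied to the product rule for f(g) = f(0) + g ·
    -- (`tail f`)(g).
    D-⊚ : ∀ f → D (f ⊚ g) ≋ (D f ⊚ g) ⊛ D g
    D-⊚ f = agree⇒≋ (λ n → go n f)
      where
      θ-shift : ∀ f → θ f ≋ shift (D f)
      θ-shift f zero    = ≈-refl
      θ-shift f (suc n) = ≈-refl

      go : ∀ n f → Agree n (D (f ⊚ g)) ((D f ⊚ g) ⊛ D g)
      go (suc n) f i i<n = begin
        D (f ⊚ g) i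
          ≈⟨ D-cong (⊚-unfold f g0) i ⟩
        D (const (f 0) ⊕ g ⊛ F) i
          ≈⟨ S.trans (D-⊕ (const (f 0)) (g ⊛ F)) (S.+-cong (D-const (f 0)) (D-⊛ g F)) i ⟩
        0# + ((D g ⊛ F) i + (g ⊛ D F) i)
          ≈⟨ ≈-trans (+-identityˡ _) (+-congˡ (⊛-vanish-agree g0 (go n (tail f)) i i<n)) ⟩
        (D g ⊛ F) i + (g ⊛ (F′ ⊛ D g)) i
          ≈⟨ solve 4 (λ d x F F′ → (d :* F :+ x :* (F′ :* d)) := ((F :+ x :* F′) :* d))
               S.refl (D g) g F F′ i ⟩
        ((F ⊕ g ⊛ F′) ⊛ D g) i
          ≈⟨ S.*-congʳ {D g} (S.trans (⊚-⊕ (tail f) (θ (tail f)) g)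
               (S.+-congˡ {F} (S.trans (⊚-congˡ g (θ-shift (tail f))) (⊚-shift (D (tail f)))))) i ⟨
        ((D f ⊚ g) ⊛ D g) i ∎
        where
        open ≈R
        open Solver using (solve; _:+_; _:*_; _:=_)
        F = tail f ⊚ g
        F′ = D (tail f) ⊚ g

  -- If r² = (1 - t²)(1 - a t²) and s inverts ∫ 1/r, then s′ = r(s), so that
  -- s′² = (1 - s²)(1 - a s²), and differentiating gives 2 s″ = 2 (2a s³ - (1 + a) s).
  -- The factor 2 stays, since it need not be invertible in R.
  inverse-integral-ode : ∀ a {f r s} → s 0 ≈ 0# → f ⊚ s ≋ var → r ⊛ D f ≋ S.1# →
    r ⊛ r ≋ (S.1# ⊕ ⊖ (var ⊛ var)) ⊛ (S.1# ⊕ ⊖ (const a ⊛ (var ⊛ var))) →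
    ∀ n → let w = - (1# + a) * s n + (a + a) * (s ⊛ (s ⊛ s)) n in D (D s) n + D (D s) n ≈ w + w
  inverse-integral-ode a {f} {r} {s} s0 f∘s r-Df r² n = ≈-trans (ode n) (+-cong (pointwise n) (pointwise n))
    where
    open Composition {s} s0
    open ≋R
    open Solver using (solve; con; _:+_; _:*_; _:=_)

    ρ = r ⊚ s
    γ = D f ⊚ s
    α = const a
    -- The solver works in semirings, so -1 enters as an opaque variable; its one relation `m²` is
    -- applied by hand at the end of `ode`.
    m = ⊖ S.1#

    ρ-γ : ρ ⊛ γ ≋ S.1#
    ρ-γ = S.trans (S.sym (⊚-⊛ r (D f))) (S.trans (⊚-congˡ s r-Df) (⊚-const 1# s))

    Ds : D s ≋ ρ
    Ds = begin
      D s              ≈⟨ S.*-identityˡ (D s) ⟨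
      S.1# ⊛ D s       ≈⟨ S.*-congʳ {D s} ρ-γ ⟨
      (ρ ⊛ γ) ⊛ D s    ≈⟨ S.*-assoc ρ γ (D s) ⟩
      ρ ⊛ (γ ⊛ D s)    ≈⟨ S.*-congˡ {ρ} (S.trans (S.sym (D-⊚ f)) (S.trans (D-cong f∘s) D-var)) ⟩
      ρ ⊛ S.1#         ≈⟨ S.*-identityʳ ρ ⟩
      ρ                ∎

    m² : m ⊛ m ≋ S.1#
    m² = S.trans (SP.-1*x≈-x m) (SP.-‿involutive S.1#)

    var²∘s : (var ⊛ var) ⊚ s ≋ s ⊛ s
    var²∘s = S.trans (⊚-⊛ var var) (S.*-cong ⊚-var ⊚-var)

    factor : ∀ h → (S.1# ⊕ ⊖ h) ⊚ s ≋ S.1# ⊕ m ⊛ (h ⊚ s)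
    factor h = begin
      (S.1# ⊕ ⊖ h) ⊚ s
        ≈⟨ ⊚-⊕ S.1# (⊖ h) s ⟩
      (S.1# ⊚ s) ⊕ ((⊖ h) ⊚ s)
        ≈⟨ S.+-cong (⊚-const 1# s) (⊚-congˡ {⊖ h} {m ⊛ h} s (S.sym (SP.-1*x≈-x h))) ⟩
      S.1# ⊕ ((m ⊛ h) ⊚ s)
        ≈⟨ S.+-congˡ {S.1#} (⊚-⊛ m h) ⟩
      S.1# ⊕ (m ⊚ s) ⊛ (h ⊚ s)
        ≈⟨ S.+-congˡ {S.1#} (S.*-congʳ {h ⊚ s} (S.trans (⊚-congˡ {m} {const (- 1#)} s m-const)
             (S.trans (⊚-const (- 1#) s) (S.sym m-const)))) ⟩
      S.1# ⊕ m ⊛ (h ⊚ s) ∎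
      where
      m-const : m ≋ const (- 1#)
      m-const zero    = ≈-refl
      m-const (suc n) = RP.-0#≈0#

    ρ² : ρ ⊛ ρ ≋ (S.1# ⊕ m ⊛ (s ⊛ s)) ⊛ (S.1# ⊕ m ⊛ (α ⊛ (s ⊛ s)))
    ρ² = begin
      ρ ⊛ ρ
        ≈⟨ ⊚-⊛ r r ⟨
      (r ⊛ r) ⊚ s
        ≈⟨ ⊚-congˡ s r² ⟩
      ((S.1# ⊕ ⊖ (var ⊛ var)) ⊛ (S.1# ⊕ ⊖ (α ⊛ (var ⊛ var)))) ⊚ s
        ≈⟨ ⊚-⊛ (S.1# ⊕ ⊖ (var ⊛ var)) (S.1# ⊕ ⊖ (α ⊛ (var ⊛ var))) ⟩
      ((S.1# ⊕ ⊖ (var ⊛ var)) ⊚ s) ⊛ ((S.1# ⊕ ⊖ (α ⊛ (var ⊛ var))) ⊚ s)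
        ≈⟨ S.*-cong (factor (var ⊛ var)) (factor (α ⊛ (var ⊛ var))) ⟩
      (S.1# ⊕ m ⊛ ((var ⊛ var) ⊚ s)) ⊛ (S.1# ⊕ m ⊛ ((α ⊛ (var ⊛ var)) ⊚ s))
        ≈⟨ S.*-cong (S.+-congˡ {S.1#} (S.*-congˡ {m} var²∘s))
             (S.+-congˡ {S.1#} (S.*-congˡ {m} (S.trans (⊚-⊛ α (var ⊛ var)) (S.*-cong (⊚-const a s) var²∘s)))) ⟩
      (S.1# ⊕ m ⊛ (s ⊛ s)) ⊛ (S.1# ⊕ m ⊛ (α ⊛ (s ⊛ s))) ∎

    D-const* : ∀ {c} h → D c ≋ S.0# → D (c ⊛ h) ≋ c ⊛ D h
    D-const* {c} h Dc = S.trans (D-⊛ c h)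
      (S.trans (S.+-congʳ (S.trans (S.*-congʳ {h} Dc) (S.zeroˡ h))) (S.+-identityˡ (c ⊛ D h)))

    Dm : D m ≋ S.0#
    Dm n = ≈-trans (×-congʳ (suc n) RP.-0#≈0#) (·-zeroʳ (suc n))

    D-1+m* : ∀ h → D (S.1# ⊕ m ⊛ h) ≋ m ⊛ D h
    D-1+m* h = S.trans (D-⊕ S.1# (m ⊛ h))
      (S.trans (S.+-cong (D-const 1#) (D-const* h Dm)) (S.+-identityˡ (m ⊛ D h)))

    Ds² : D (s ⊛ s) ≋ ρ ⊛ s ⊕ s ⊛ ρ
    Ds² = S.trans (D-⊛ s s) (S.+-cong (S.*-congʳ {s} Ds) (S.*-congˡ {s} Ds))

    P = S.1# ⊕ m ⊛ (s ⊛ s)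
    Q = S.1# ⊕ m ⊛ (α ⊛ (s ⊛ s))
    W = m ⊛ ((S.1# ⊕ α) ⊛ s) ⊕ (α ⊕ α) ⊛ (s ⊛ (s ⊛ s))

    Dρ² : D ρ ⊛ ρ ⊕ ρ ⊛ D ρ
        ≋ (m ⊛ (ρ ⊛ s ⊕ s ⊛ ρ)) ⊛ Q ⊕ P ⊛ (m ⊛ (α ⊛ (ρ ⊛ s ⊕ s ⊛ ρ)))
    Dρ² = begin
      D ρ ⊛ ρ ⊕ ρ ⊛ D ρ   ≈⟨ D-⊛ ρ ρ ⟨
      D (ρ ⊛ ρ)           ≈⟨ D-cong ρ² ⟩
      D (P ⊛ Q)           ≈⟨ D-⊛ P Q ⟩
      D P ⊛ Q ⊕ P ⊛ D Q   ≈⟨ S.+-cong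
          (S.*-congʳ {Q} (S.trans (D-1+m* (s ⊛ s)) (S.*-congˡ {m} Ds²)))
          (S.*-congˡ {P} (S.trans (D-1+m* (α ⊛ (s ⊛ s)))
            (S.*-congˡ {m} (S.trans (D-const* (s ⊛ s) (D-const a)) (S.*-congˡ {α} Ds²))))) ⟩
      (m ⊛ (ρ ⊛ s ⊕ s ⊛ ρ)) ⊛ Q ⊕ P ⊛ (m ⊛ (α ⊛ (ρ ⊛ s ⊕ s ⊛ ρ))) ∎

    ode : D (D s) ⊕ D (D s) ≋ W ⊕ W
    ode = begin
      D (D s) ⊕ D (D s)
        ≈⟨ S.+-cong (D-cong Ds) (D-cong Ds) ⟩
      D ρ ⊕ D ρ
        ≈⟨ S.*-identityˡ (D ρ ⊕ D ρ) ⟨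
      S.1# ⊛ (D ρ ⊕ D ρ)
        -- `γ` is 1/ρ. Inserting ργ = 1 produces the derivative of ρ², which is known; every term of
        -- the result contains ρ, and that ρ cancels against `γ`.
        ≈⟨ S.*-congʳ {D ρ ⊕ D ρ} ρ-γ ⟨
      (ρ ⊛ γ) ⊛ (D ρ ⊕ D ρ)
        ≈⟨ solve 3 (λ ρ γ δ → ((ρ :* γ) :* (δ :+ δ)) := (γ :* (δ :* ρ :+ ρ :* δ))) S.refl ρ γ (D ρ) ⟩
      γ ⊛ (D ρ ⊛ ρ ⊕ ρ ⊛ D ρ)
        ≈⟨ S.*-congˡ {γ} Dρ² ⟩
      γ ⊛ ((m ⊛ (ρ ⊛ s ⊕ s ⊛ ρ)) ⊛ Q ⊕ P ⊛ (m ⊛ (α ⊛ (ρ ⊛ s ⊕ s ⊛ ρ))))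
        ≈⟨ solve 5 (λ ρ γ m α s →
               (γ :* ((m :* (ρ :* s :+ s :* ρ)) :* (con 1 :+ m :* (α :* (s :* s)))
                 :+ (con 1 :+ m :* (s :* s)) :* (m :* (α :* (ρ :* s :+ s :* ρ)))))
            := ((ρ :* γ) :* ((m :* ((con 1 :+ α) :* s) :+ (m :* m) :* ((α :+ α) :* (s :* (s :* s))))
                 :+ (m :* ((con 1 :+ α) :* s) :+ (m :* m) :* ((α :+ α) :* (s :* (s :* s)))))))
             S.refl ρ γ m α s ⟩
      (ρ ⊛ γ) ⊛ (V ⊕ V)
        ≈⟨ S.trans (S.*-congʳ {V ⊕ V} ρ-γ) (S.*-identityˡ (V ⊕ V)) ⟩
      V ⊕ V
        ≈⟨ S.+-cong V≋W V≋W ⟩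
      W ⊕ W ∎
      where
      U = (α ⊕ α) ⊛ (s ⊛ (s ⊛ s))
      V = m ⊛ ((S.1# ⊕ α) ⊛ s) ⊕ (m ⊛ m) ⊛ U

      V≋W : V ≋ W
      V≋W = S.+-congˡ {m ⊛ ((S.1# ⊕ α) ⊛ s)} (S.trans (S.*-congʳ {U} m²) (S.*-identityˡ U))

    pointwise : ∀ n → W n ≈ - (1# + a) * s n + (a + a) * (s ⊛ (s ⊛ s)) n
    pointwise n = +-cong
      (≈-trans (SP.-1*x≈-x ((S.1# ⊕ α) ⊛ s) n)
        (≈-trans (-‿cong (≈-trans (S.*-congʳ {s} (S.sym (const-+ 1# a)) n) (⊛-constˡ (1# + a) s n)))
          (RP.-‿distribˡ-* (1# + a) (s n))))
      (≈-trans (S.*-congʳ {s ⊛ (s ⊛ s)} (S.sym (const-+ a a)) n) (⊛-constˡ (a + a) (s ⊛ (s ⊛ s)) n))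

-- Graded cones over a ℚ-algebra

private
  module ℚR = CommutativeRing ℚ.+-*-commutativeRing
  module ℚP = RingProperties ℚR.ring

open Mult ℚR.semiring using () renaming (_×_ to _·ℚ_)

-- Fractions in ℚ are normalised by a gcd and do not compute for a variable denominator. The sums
-- are therefore compared as unnormalised fractions, where equality is cross-multiplication.
·ℚ-unit-fraction : ∀ j → suc j ·ℚ (ℤ.+ 1 ℚ./ suc j) ≡ 1ℚ
·ℚ-unit-fraction j = ≡.trans (multiple (suc j)) (ℚ.fromℚᵘ-cong {ℚᵘ.mkℚᵘ (ℤ.+ suc j) j} {ℚᵘ.1ℚᵘ}
  (ℚᵘ.*≡* (ℤ.*-comm (ℤ.+ suc j) (ℤ.+ 1))))
  where
  open ℤ-Solver
  q : ℕ → ℚᵘ.ℚᵘ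
  q m = ℚᵘ.mkℚᵘ (ℤ.+ m) j

  multiple : ∀ m → m ·ℚ (ℤ.+ 1 ℚ./ suc j) ≡ ℤ.+ m ℚ./ suc j
  multiple zero    = ≡.sym (ℚ.fromℚᵘ-cong {q 0} {ℚᵘ.0ℚᵘ} (ℚᵘ.*≡* refl))
  multiple (suc m) = ≡.trans (≡.cong ((ℤ.+ 1 ℚ./ suc j) ℚ.+_) (multiple m))
    (ℚ.toℚᵘ-injective (ℚᵘ.≃-trans (ℚ.toℚᵘ-homo-+ (ℤ.+ 1 ℚ./ suc j) (ℤ.+ m ℚ./ suc j))
      (ℚᵘ.≃-trans (ℚᵘ.+-cong (ℚ.toℚᵘ-fromℚᵘ (q 1)) (ℚ.toℚᵘ-fromℚᵘ (q m)))
        (ℚᵘ.≃-trans (ℚᵘ.*≡* (solve 2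
            (λ m d → (con (ℤ.+ 1) :* d :+ m :* d) :* d := (con (ℤ.+ 1) :+ m) :* (d :* d))
            refl (ℤ.+ m) (ℤ.+ suc j)))
          (ℚᵘ.≃-sym (ℚ.toℚᵘ-fromℚᵘ (q (suc m))))))))

0≤a*b : ∀ {a b} → 0ℚ ℚ.≤ a → 0ℚ ℚ.≤ b → 0ℚ ℚ.≤ a ℚ.* b
0≤a*b {a} {b} 0≤a 0≤b = ℚ.nonNegative⁻¹ (a ℚ.* b)
  {{ℚ.nonNeg*nonNeg⇒nonNeg a {{ℚ.nonNegative 0≤a}} b {{ℚ.nonNegative 0≤b}}}}

0≤fraction : ∀ m j → 0ℚ ℚ.≤ ℤ.+ m ℚ./ suc j
0≤fraction m j = ℚ.nonNegative⁻¹ (ℤ.+ m ℚ./ suc j) {{ℚ.normalize-nonNeg m (suc j)}}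

sgn : ℕ → ℚ
sgn zero    = 1ℚ
sgn (suc n) = ℚ.- sgn n

sgn-+2* : ∀ l k → sgn (l ℕ.+ 2 ℕ.* k) ≡ sgn l
sgn-+2* l zero    = ≡.cong sgn (ℕ.+-identityʳ l)
sgn-+2* l (suc k) = ≡.trans
  (≡.cong sgn (solve 2 (λ l k → l :+ con 2 :* (con 1 :+ k) := con 2 :+ (l :+ con 2 :* k)) refl l k))
  (≡.trans (ℚP.-‿involutive (sgn (l ℕ.+ 2 ℕ.* k))) (sgn-+2* l k))
  where open ℕ-Solver

sgn*sgn : ∀ n → sgn n ℚ.* sgn n ≡ 1ℚ
sgn*sgn zero    = refl
sgn*sgn (suc n) = begin
  ℚ.- s ℚ.* ℚ.- s       ≡⟨ ℚ.neg-distribˡ-* s (ℚ.- s) ⟨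
  ℚ.- (s ℚ.* ℚ.- s)     ≡⟨ ≡.cong ℚ.-_ (ℚ.neg-distribʳ-* s s) ⟨
  ℚ.- (ℚ.- (s ℚ.* s))   ≡⟨ ℚP.-‿involutive (s ℚ.* s) ⟩
  s ℚ.* s               ≡⟨ sgn*sgn n ⟩
  1ℚ                    ∎
  where
  open ≡.≡-Reasoning
  s = sgn n

module ℚ-Algebra {c ℓ} (A : CommutativeRing c ℓ) (κ : ℚ → CommutativeRing.Carrier A)
  (κ-isRingHomomorphism : RingMorphisms.IsRingHomomorphism ℚ.+-*-rawRing (CommutativeRing.rawRing A) κ)
  where

  open CommutativeRing A renaming (refl to ≈-refl; sym to ≈-sym; trans to ≈-trans; zero to *-zero)
  open RingMorphisms.IsRingHomomorphism κ-isRingHomomorphism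
    using () renaming (+-homo to κ-+; *-homo to κ-*; 0#-homo to κ-0; 1#-homo to κ-1; -‿homo to κ-neg; ⟦⟧-cong to κ-cong)
  open RingProperties ring using (-‿distribˡ-*)
  open Series A hiding (solve)
  open SeriesCalculus A using (D)
  open Mult semiring using (×-comm-*; ×-assoc-*) renaming (_×_ to _·_)
  open Exp semiring using (_^_; ^-homo-*; ^-congʳ)
  open AdditiveSum +-commutativeMonoid using (sum; sum-remove; ∑-distrib-+; sum-cong-≋; sum-replicate-zero)
  open SemiringSolver commutativeSemiring using (solve; _:+_; _:*_; _:=_)
  open SetoidReasoning setoid

  ·-κ : ∀ n a → n · κ a ≈ κ (n ·ℚ a)
  ·-κ zero    a = ≈-sym κ-0
  ·-κ (suc n) a = ≈-trans (+-congˡ (·-κ n a)) (≈-sym (κ-+ a (n ·ℚ a)))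

  ·-unit-fraction : ∀ j p → suc j · (κ (ℤ.+ 1 ℚ./ suc j) * p) ≈ p
  ·-unit-fraction j p = begin
    suc j · (u * p)                        ≈⟨ ×-assoc-* (suc j) u p ⟨
    (suc j · u) * p                        ≈⟨ *-congʳ (·-κ (suc j) (ℤ.+ 1 ℚ./ suc j)) ⟩
    κ (suc j ·ℚ (ℤ.+ 1 ℚ./ suc j)) * p      ≈⟨ *-congʳ (≈-trans (κ-cong (·ℚ-unit-fraction j)) κ-1) ⟩
    1# * p                                 ≈⟨ *-identityˡ p ⟩
    p                                      ∎
    where u = κ (ℤ.+ 1 ℚ./ suc j)

  unit-fraction-· : ∀ j p → κ (ℤ.+ 1 ℚ./ suc j) * (suc j · p) ≈ p
  unit-fraction-· j p = ≈-trans (×-comm-* (suc j) _ p) (·-unit-fraction j p)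

  -- Removes the factor 2 that `inverse-integral-ode` leaves in place.
  double-injective : ∀ {p q} → p + p ≈ q + q → p ≈ q
  double-injective {p} {q} e = ≈-trans (≈-sym (halve p)) (≈-trans (*-congˡ e) (halve q))
    where
    halve : ∀ p → κ ½ * (p + p) ≈ p
    halve p = ≈-trans (*-congˡ (+-congˡ (≈-sym (+-identityʳ p)))) (unit-fraction-· 1 p)

  sum-single : ∀ {n} (t : Fin (suc n) → Carrier) i → (∀ j → j ≢ i → t j ≈ 0#) → sum t ≈ t i
  sum-single {n} t i t≈0 = begin
    sum t                             ≈⟨ sum-remove t ⟩
    t i + sum (λ j → t (punchIn i j)) ≈⟨ +-congˡ (sum-cong-≋ (λ j → t≈0 (punchIn i j) (Fin.punchInᵢ≢i i j))) ⟩
    t i + sum {n} (λ _ → 0#)          ≈⟨ +-congˡ (sum-replicate-zero n) ⟩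
    t i + 0#                          ≈⟨ +-identityʳ (t i) ⟩
    t i                               ∎

  -- Expansions in xᵏ(1+x)ᵐ⁻²ᵏ and the graded cone.

  module GammaCone (x : Carrier) where

    y : Carrier
    y = 1# + x

    γ-term : ∀ m → (Fin (suc ⌊ m /2⌋) → ℚ) → Fin (suc ⌊ m /2⌋) → Carrier
    γ-term m γ k = κ (γ k) * x ^ toℕ k * y ^ (m ∸ 2 ℕ.* toℕ k)

    γ-term-0 : ∀ m {γ} k → γ k ≡ 0ℚ → γ-term m γ k ≈ 0#
    γ-term-0 m k γk≡0 =
      ≈-trans (*-congʳ (≈-trans (*-congʳ (≈-trans (κ-cong γk≡0) κ-0)) (zeroˡ (x ^ toℕ k)))) (zeroˡ _)

    γ-term-+ : ∀ m γ δ k → γ-term m (λ k → γ k ℚ.+ δ k) k ≈ γ-term m γ k + γ-term m δ k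
    γ-term-+ m γ δ k = ≈-trans
      (*-congʳ (≈-trans (*-congʳ (κ-+ (γ k) (δ k))) (distribʳ (x ^ toℕ k) (κ (γ k)) (κ (δ k)))))
      (distribʳ _ _ _)

    -- For A = ℚ[x] this is the second component of `GammaPositive`.
    GammaExpansion : ℕ → Carrier → Set ℓ
    GammaExpansion m p = Σ (Fin (suc ⌊ m /2⌋) → ℚ) λ γ → p ≈ sum (γ-term m γ) × (∀ k → 0ℚ ℚ.≤ γ k)

    expansion-resp : ∀ {m p q} → p ≈ q → GammaExpansion m p → GammaExpansion m q
    expansion-resp p≈q (γ , p≈ , 0≤γ) = γ , ≈-trans (≈-sym p≈q) p≈ , 0≤γ

    expansion-0 : ∀ m → GammaExpansion m 0#
    expansion-0 m = (λ _ → 0ℚ)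
      , ≈-sym (≈-trans (sum-cong-≋ {suc ⌊ m /2⌋} {γ-term m (λ _ → 0ℚ)} (λ k → γ-term-0 m {λ _ → 0ℚ} k refl))
          (sum-replicate-zero (suc ⌊ m /2⌋)))
      , λ _ → ℚ.≤-refl

    expansion-+ : ∀ {m p q} → GammaExpansion m p → GammaExpansion m q → GammaExpansion m (p + q)
    expansion-+ {m} (γ , p≈ , 0≤γ) (δ , q≈ , 0≤δ) = (λ k → γ k ℚ.+ δ k)
      , ≈-trans (+-cong p≈ q≈) (≈-trans (≈-sym (∑-distrib-+ (γ-term m γ) (γ-term m δ)))
          (sum-cong-≋ {suc ⌊ m /2⌋} (λ k → ≈-sym (γ-term-+ m γ δ k))))
      , λ k → ℚ.+-mono-≤ (0≤γ k) (0≤δ k)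

    -- The coefficient family is `a` at index `k` and zero elsewhere. The index is in range because
    -- half of l + 2k is at least k.
    expansion-monomial : ∀ {a} k l → 0ℚ ℚ.≤ a → GammaExpansion (l ℕ.+ 2 ℕ.* k) (κ a * x ^ k * y ^ l)
    expansion-monomial {a} k l 0≤a = γ , ≈-sym (≈-trans (sum-single (γ-term m γ) i off) on) , 0≤γ
      where
      m = l ℕ.+ 2 ℕ.* k

      k≤⌊m/2⌋ : k ℕ.≤ ⌊ m /2⌋
      k≤⌊m/2⌋ = ≡.subst (ℕ._≤ ⌊ m /2⌋) (≡.trans (≡.cong (λ j → ⌊ k ℕ.+ j /2⌋) (ℕ.+-identityʳ k)) (≡.sym (ℕ.n≡⌊n+n/2⌋ k)))
        (ℕ.⌊n/2⌋-mono (ℕ.m≤n+m (2 ℕ.* k) l))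

      i : Fin (suc ⌊ m /2⌋)
      i = fromℕ< (s≤s k≤⌊m/2⌋)

      γ : Fin (suc ⌊ m /2⌋) → ℚ
      γ j with j Fin.≟ i
      ... | yes _ = a
      ... | no  _ = 0ℚ

      0≤γ : ∀ j → 0ℚ ℚ.≤ γ j
      0≤γ j with j Fin.≟ i
      ... | yes _ = 0≤a
      ... | no  _ = ℚ.≤-refl

      off : ∀ j → j ≢ i → γ-term m γ j ≈ 0#
      off j j≢i = γ-term-0 m {γ} j γj≡0
        where
        γj≡0 : γ j ≡ 0ℚ
        γj≡0 with j Fin.≟ i
        ... | yes j≡i = contradiction j≡i j≢i
        ... | no  _   = refl

      on : γ-term m γ i ≈ κ a * x ^ k * y ^ l
      on with i Fin.≟ i
      ... | no  i≢i = contradiction refl i≢i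
      ... | yes _   rewrite Fin.toℕ-fromℕ< (s≤s k≤⌊m/2⌋) = *-congˡ (^-congʳ y (ℕ.m+n∸n≡m l (2 ℕ.* k)))

    -- The grading gives x weight 4 and - (1 + x) weight 2.  With w = 2 n it absorbs the sign
    -- (-1)ⁿ of the expansion of sn, and it has no nonzero elements of odd weight, just as
    -- sn has no coefficients of even degree.
    data Cone (w : ℕ) : Carrier → Set (c ⊔ ℓ) where
      zero     : Cone w 0#
      monomial : ∀ a k l → 0ℚ ℚ.≤ a → 2 ℕ.* (l ℕ.+ 2 ℕ.* k) ≡ w → Cone w (κ a * x ^ k * (- y) ^ l)
      add      : ∀ {p q} → Cone w p → Cone w q → Cone w (p + q)
      resp     : ∀ {p q} → p ≈ q → Cone w p → Cone w q

    -- Bilinearity reduces to two monomials, whose exponents and weights add and whose coefficients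
    -- stay nonnegative. Generating the cone inductively avoids convolving families of coefficients.
    cone-* : ∀ {v w p q} → Cone v p → Cone w q → Cone (v ℕ.+ w) (p * q)
    cone-* zero        q∈ = resp (≈-sym (zeroˡ _)) zero
    cone-* (add p∈ p′∈) q∈ = resp (≈-sym (distribʳ _ _ _)) (add (cone-* p∈ q∈) (cone-* p′∈ q∈))
    cone-* (resp e p∈) q∈ = resp (*-congʳ e) (cone-* p∈ q∈)
    cone-* p∈@(monomial _ _ _ _ _) zero         = resp (≈-sym (zeroʳ _)) zero
    cone-* p∈@(monomial _ _ _ _ _) (add q∈ q′∈) = resp (≈-sym (distribˡ _ _ _)) (add (cone-* p∈ q∈) (cone-* p∈ q′∈))
    cone-* p∈@(monomial _ _ _ _ _) (resp e q∈)  = resp (*-congˡ e) (cone-* p∈ q∈)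
    cone-* (monomial a k l 0≤a refl) (monomial a′ k′ l′ 0≤a′ refl) = resp
      (≈-trans (*-cong (*-cong (κ-* a a′) (^-homo-* x k k′)) (^-homo-* (- y) l l′))
        (solve 6 (λ a a′ u u′ v v′ → ((a :* a′) :* (u :* u′) :* (v :* v′)) := ((a :* u :* v) :* (a′ :* u′ :* v′)))
          ≈-refl (κ a) (κ a′) (x ^ k) (x ^ k′) ((- y) ^ l) ((- y) ^ l′)))
      (monomial (a ℚ.* a′) (k ℕ.+ k′) (l ℕ.+ l′) (0≤a*b 0≤a 0≤a′)
        (ℕ-Solver.solve 4 (λ k k′ l l′ → con 2 ⟨*⟩ ((l ⟨+⟩ l′) ⟨+⟩ con 2 ⟨*⟩ (k ⟨+⟩ k′))
            ⟨=⟩ con 2 ⟨*⟩ (l ⟨+⟩ con 2 ⟨*⟩ k) ⟨+⟩ con 2 ⟨*⟩ (l′ ⟨+⟩ con 2 ⟨*⟩ k′)) refl k k′ l l′))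
      where open ℕ-Solver using (con) renaming (_:+_ to infixl 6 _⟨+⟩_; _:*_ to infixl 7 _⟨*⟩_; _:=_ to infix 4 _⟨=⟩_)

    cone-constant : ∀ {a} → 0ℚ ℚ.≤ a → Cone 0 (κ a)
    cone-constant {a} 0≤a = resp (≈-trans (*-identityʳ _) (*-identityʳ (κ a))) (monomial a 0 0 0≤a refl)

    cone-1 : Cone 0 1#
    cone-1 = resp κ-1 (cone-constant (0≤fraction 1 0))

    cone-x : Cone 4 x
    cone-x = resp (≈-trans (*-identityʳ _) (≈-trans (*-congʳ κ-1) (≈-trans (*-identityˡ _) (*-identityʳ x))))
      (monomial 1ℚ 1 0 (0≤fraction 1 0) refl)

    cone-[-y] : Cone 2 (- y)
    cone-[-y] = resp
      (≈-trans (*-cong (≈-trans (*-congʳ κ-1) (*-identityˡ _)) (*-identityʳ (- y))) (*-identityˡ (- y)))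
      (monomial 1ℚ 0 1 (0≤fraction 1 0) refl)

    -- Differentiation multiplies coefficients by positive integers; their inverses have weight 0,
    -- so dividing them out stays in the cone.
    cone-÷ : ∀ {w p} j → Cone w (suc j · p) → Cone w p
    cone-÷ {p = p} j p∈ = resp (unit-fraction-· j p) (cone-* (cone-constant (0≤fraction 1 j)) p∈)

    reindex : ∀ {v w p} → v ≡ w → Cone v p → Cone w p
    reindex refl p∈ = p∈

    -- The offset `v` serves the recursion of `_⊛_`: in `tail f`, the weight at each index is one
    -- higher. The bounds `i ≤ n` let the lemma be used inside a strong induction.
    cone-⊛ : ∀ v {f g} n → (∀ i → i ℕ.≤ n → Cone (v ℕ.+ i) (f i)) → (∀ i → i ℕ.≤ n → Cone i (g i)) →
      Cone (v ℕ.+ n) ((f ⊛ g) n)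
    cone-⊛ v zero    f∈ g∈ = reindex (ℕ.+-identityʳ (v ℕ.+ 0)) (cone-* (f∈ 0 z≤n) (g∈ 0 z≤n))
    cone-⊛ v (suc n) f∈ g∈ = add
      (reindex (≡.cong (ℕ._+ suc n) (ℕ.+-identityʳ v)) (cone-* (f∈ 0 z≤n) (g∈ (suc n) ℕ.≤-refl)))
      (reindex (≡.sym (ℕ.+-suc v n)) (cone-⊛ (suc v) n
        (λ i i≤n → reindex (ℕ.+-suc v i) (f∈ (suc i) (s≤s i≤n)))
        (λ i i≤n → g∈ i (ℕ.m≤n⇒m≤1+n i≤n))))

    -- Coefficients of a solution of the differential equation.

    module Solution {s : Series} (s0 : s 0 ≈ 0#) (s1 : s 1 ≈ 1#)
      (ode : ∀ n → D (D s) n ≈ - y * s n + (x + x) * (s ⊛ (s ⊛ s)) n) where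

      private
        module S = CommutativeRing commutativeRing

        -- Writing s = t v aligns weights with indices: coefficient n of `v` has weight n, where
        -- that of `s` would have n - 1.
        v : Series
        v = tail s

      s-⊛ : ∀ g → s ⊛ g ≋ shift (g ⊛ v)
      s-⊛ g zero    = ≈-trans (*-congʳ s0) (zeroˡ (g 0))
      s-⊛ g (suc n) = ≈-trans (+-congʳ (≈-trans (*-congʳ s0) (zeroˡ _))) (≈-trans (+-identityˡ _) (⊛-comm v g n))

      -- From s = t v comes s³ = t³v³; reading it at `suc n` takes off one of the three shifts.
      cube : ∀ n → (s ⊛ (s ⊛ s)) (suc n) ≈ shift (shift ((v ⊛ v) ⊛ v)) n
      cube n = begin
        (s ⊛ (s ⊛ s)) (suc n)             ≈⟨ s-⊛ (s ⊛ s) (suc n) ⟩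
        ((s ⊛ s) ⊛ v) n                   ≈⟨ ⊛-assoc s s v n ⟩
        (s ⊛ (s ⊛ v)) n                   ≈⟨ s-⊛ (s ⊛ v) n ⟩
        shift ((s ⊛ v) ⊛ v) n             ≈⟨ shift-cong (λ m → S.trans (⊛-assoc s v v) (s-⊛ (v ⊛ v)) m) n ⟩
        shift (shift ((v ⊛ v) ⊛ v)) n     ∎
        where
        shift-cong : ∀ {f g} → f ≋ g → shift f ≋ shift g
        shift-cong p zero    = ≈-refl
        shift-cong p (suc n) = p n

      recurrence : ∀ n →
        suc (suc n) · (suc (suc (suc n)) · v (suc (suc n))) ≈ - y * v n + (x + x) * shift (shift ((v ⊛ v) ⊛ v)) n
      recurrence n = ≈-trans (ode (suc n)) (+-congˡ (*-congˡ (cube n)))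

      -- Strong induction on the recurrence for `v (n + 2)`. Both of its terms have weight n + 2:
      -- `- y` adds 2 to the weight of `v n`, while the cubic term gets 4 from x and n - 2 from the
      -- three coefficients of `v`.
      cone-tail : ∀ n → Cone n (v n)
      cone-tail = <-rec _ step
        where
        step : ∀ n → (∀ {i} → i ℕ.< n → Cone i (v i)) → Cone n (v n)
        step zero          _  = resp (≈-sym s1) cone-1
        -- `v 1` is `s 2`. As `s 0` vanishes, so does the right side of the equation at index 0.
        step (suc zero)    _  = cone-÷ 1 (cone-÷ 0 (resp (≈-sym (ode 0)) (add
          (resp (≈-sym (≈-trans (*-congˡ s0) (zeroʳ (- y)))) zero)
          (resp (≈-sym (≈-trans (*-congˡ (≈-trans (*-congʳ s0) (zeroˡ _))) (zeroʳ (x + x)))) zero))))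
        step (suc (suc n)) ih = cone-÷ (suc (suc n)) (cone-÷ (suc n) (resp (≈-sym (recurrence n))
          (add (cone-* cone-[-y] (ih (ℕ.m≤n⇒m≤1+n ℕ.≤-refl))) (cubic n ih))))
          where
          cubic : ∀ n → (∀ {i} → i ℕ.< suc (suc n) → Cone i (v i)) →
            Cone (suc (suc n)) ((x + x) * shift (shift ((v ⊛ v) ⊛ v)) n)
          cubic zero          _  = resp (≈-sym (zeroʳ (x + x))) zero
          cubic (suc zero)    _  = resp (≈-sym (zeroʳ (x + x))) zero
          cubic (suc (suc n)) ih = cone-* (add cone-x cone-x)
            (cone-⊛ 0 n (λ i i≤n → let v∈ = λ j j≤i → below (ℕ.≤-trans j≤i i≤n) in cone-⊛ 0 i v∈ v∈) (λ i → below))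
            where
            below : ∀ {i} → i ℕ.≤ n → Cone i (v i)
            below i≤n = ih (s≤s (ℕ.≤-trans i≤n (ℕ.m≤n+m n 3)))

    [-y]^ : ∀ l → (- y) ^ l ≈ κ (sgn l) * y ^ l
    [-y]^ zero    = ≈-sym (≈-trans (*-congʳ κ-1) (*-identityˡ 1#))
    [-y]^ (suc l) = begin
      - y * (- y) ^ l             ≈⟨ *-congˡ ([-y]^ l) ⟩
      - y * (κ (sgn l) * y ^ l)   ≈⟨ -‿distribˡ-* y _ ⟨
      - (y * (κ (sgn l) * y ^ l)) ≈⟨ -‿cong (solve 3 (λ y a u → (y :* (a :* u)) := (a :* (y :* u)))
                                       ≈-refl y (κ (sgn l)) (y ^ l)) ⟩
      - (κ (sgn l) * y ^ suc l)   ≈⟨ -‿distribˡ-* _ _ ⟩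
      - κ (sgn l) * y ^ suc l     ≈⟨ *-congʳ (κ-neg (sgn l)) ⟨
      κ (sgn (suc l)) * y ^ suc l ∎

    -- A monomial of weight 2n has l + 2k = n, so the sign (-1)ˡ of `(- y) ^ l` equals (-1)ⁿ and
    -- `sgn n` cancels it. The factor `a` makes room for the factorial in `J`.
    cone⇒expansion : ∀ n {a p} → 0ℚ ℚ.≤ a → Cone (2 ℕ.* n) p → GammaExpansion n (κ (sgn n ℚ.* a) * p)
    cone⇒expansion n 0≤a zero         = expansion-resp (≈-sym (zeroʳ _)) (expansion-0 n)
    cone⇒expansion n 0≤a (add p∈ q∈)  = expansion-resp (≈-sym (distribˡ _ _ _))
      (expansion-+ (cone⇒expansion n 0≤a p∈) (cone⇒expansion n 0≤a q∈))
    cone⇒expansion n 0≤a (resp e p∈)  = expansion-resp (*-congˡ e) (cone⇒expansion n 0≤a p∈)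
    cone⇒expansion n {a} 0≤a (monomial b k l 0≤b e) with ℕ.*-cancelˡ-≡ (l ℕ.+ 2 ℕ.* k) n 2 e
    ... | refl = expansion-resp (begin
        κ (a ℚ.* b) * x ^ k * y ^ l
          ≈⟨ *-congʳ (*-congʳ (κ-cong signs)) ⟩
        κ (σ ℚ.* a ℚ.* (b ℚ.* sgn l)) * x ^ k * y ^ l
          ≈⟨ *-congʳ (*-congʳ (≈-trans (κ-* _ _) (*-congˡ (κ-* b (sgn l))))) ⟩
        κ (σ ℚ.* a) * (κ b * κ (sgn l)) * x ^ k * y ^ l
          ≈⟨ solve 5 (λ a b s u v → (a :* (b :* s) :* u :* v) := (a :* (b :* u :* (s :* v)))) ≈-refl
               (κ (σ ℚ.* a)) (κ b) (κ (sgn l)) (x ^ k) (y ^ l) ⟩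
        κ (σ ℚ.* a) * (κ b * x ^ k * (κ (sgn l) * y ^ l))
          ≈⟨ *-congˡ (*-congˡ ([-y]^ l)) ⟨
        κ (σ ℚ.* a) * (κ b * x ^ k * (- y) ^ l) ∎)
      (expansion-monomial k l (0≤a*b 0≤a 0≤b))
      where
      σ = sgn (l ℕ.+ 2 ℕ.* k)
      signs : a ℚ.* b ≡ σ ℚ.* a ℚ.* (b ℚ.* sgn l)
      signs = ≡.sym (≡.trans (≡.cong (λ s → s ℚ.* a ℚ.* (b ℚ.* sgn l)) (sgn-+2* l k))
        (≡.trans (ℚ-Solver.solve 3 (λ s a b → (s ⟨*⟩ a ⟨*⟩ (b ⟨*⟩ s)) ⟨=⟩ ((s ⟨*⟩ s) ⟨*⟩ (a ⟨*⟩ b))) refl (sgn l) a b)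
          (≡.trans (≡.cong (ℚ._* (a ℚ.* b)) (sgn*sgn l)) (ℚ.*-identityˡ (a ℚ.* b)))))
        where
        module ℚ-Solver = SemiringSolver ℚR.commutativeSemiring
        open ℚ-Solver using () renaming (_:*_ to infixl 7 _⟨*⟩_; _:=_ to infix 4 _⟨=⟩_)

-- Polynomials and sn

-- Opened only here, because it brings the series operations over ℚ[x] into scope.
open import Defs
open HeytingProperties ℚ.heytingCommutativeRing using (x#0y#0→xy#0)

private
  module P = CommutativeRing ℚ[x]

-- Coefficients of sums and products of polynomials.

coeff-+ : ∀ p q n → coeff (p +ₚ q) n ≡ coeff p n ℚ.+ coeff q n
coeff-+ []      q       n       = ≡.sym (ℚ.+-identityˡ _)
coeff-+ (a ∷ p) []      n       = ≡.sym (ℚ.+-identityʳ _)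
coeff-+ (a ∷ p) (b ∷ q) zero    = refl
coeff-+ (a ∷ p) (b ∷ q) (suc n) = coeff-+ p q n

coeff-map : ∀ a q n → coeff (map (a ℚ.*_) q) n ≡ a ℚ.* coeff q n
coeff-map a []      n       = ≡.sym (ℚ.*-zeroʳ a)
coeff-map a (b ∷ q) zero    = refl
coeff-map a (b ∷ q) (suc n) = coeff-map a q n

coeff-* : ∀ p q n → coeff (p *ₚ q) n ≡ (coeff p ℚ⟦x⟧.⊛ coeff q) n
coeff-* []      q n       = ≡.sym (ℚ⟦x⟧.⊛-zeroˡ (coeff q) n)
coeff-* (a ∷ p) q zero    = ≡.trans (coeff-+ (map (a ℚ.*_) q) (0ℚ ∷ p *ₚ q) 0)
  (≡.trans (≡.cong (ℚ._+ 0ℚ) (coeff-map a q 0)) (ℚ.+-identityʳ _))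
coeff-* (a ∷ p) q (suc n) = ≡.trans (coeff-+ (map (a ℚ.*_) q) (0ℚ ∷ p *ₚ q) (suc n))
  (≡.cong₂ ℚ._+_ (coeff-map a q (suc n)) (coeff-* p q n))

coeff-constₚ : ∀ a n → coeff (constₚ a) n ≡ ℚ⟦x⟧.const a n
coeff-constₚ a zero    = refl
coeff-constₚ a (suc n) = refl

coeff-constₚ-* : ∀ a p n → coeff (constₚ a *ₚ p) n ≡ a ℚ.* coeff p n
coeff-constₚ-* a p n = ≡.trans (coeff-* (constₚ a) p n)
  (≡.trans (ℚ⟦x⟧.⊛-cong (coeff-constₚ a) (λ _ → refl) n) (ℚ⟦x⟧.⊛-constˡ a (coeff p) n))

coeff-xₚ-* : ∀ p n → coeff (xₚ *ₚ p) n ≡ ℚ⟦x⟧.shift (coeff p) n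
coeff-xₚ-* p zero    = ≡.trans (coeff-* xₚ p 0) (ℚ.*-zeroˡ (coeff p 0))
coeff-xₚ-* p (suc n) = ≡.trans (coeff-* xₚ p (suc n))
  (≡.trans (≡.cong₂ ℚ._+_ (ℚ.*-zeroˡ (coeff p (suc n)))
             (≡.trans (ℚ⟦x⟧.⊛-cong (coeff-constₚ 1ℚ) (λ _ → refl) n) (ℚ⟦x⟧.⊛-identityˡ (coeff p) n)))
    (ℚ.+-identityˡ _))

coeff-1+xₚ-* : ∀ p n → coeff ((1ₚ +ₚ xₚ) *ₚ p) n ≡ coeff p n ℚ.+ ℚ⟦x⟧.shift (coeff p) n
coeff-1+xₚ-* p n = ≡.trans (P.distribʳ p 1ₚ xₚ n)
  (≡.trans (coeff-+ (1ₚ *ₚ p) (xₚ *ₚ p) n) (≡.cong₂ ℚ._+_ (P.*-identityˡ p n) (coeff-xₚ-* p n)))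

constₚ-+ : ∀ a b → constₚ (a ℚ.+ b) ≈ₚ constₚ a +ₚ constₚ b
constₚ-+ a b zero    = refl
constₚ-+ a b (suc n) = refl

constₚ-* : ∀ a b → constₚ (a ℚ.* b) ≈ₚ constₚ a *ₚ constₚ b
constₚ-* a b zero    = ≡.sym (ℚ.+-identityʳ (a ℚ.* b))
constₚ-* a b (suc n) = refl

constₚ-0 : constₚ 0ℚ ≈ₚ []
constₚ-0 zero    = refl
constₚ-0 (suc n) = refl

constₚ-isRingHomomorphism : RingMorphisms.IsRingHomomorphism ℚ.+-*-rawRing P.rawRing constₚ
constₚ-isRingHomomorphism = record
  { isSemiringHomomorphism = record
    { isNearSemiringHomomorphism = record
      { +-isMonoidHomomorphism = record
        { isMagmaHomomorphism = record
          { isRelHomomorphism = record { cong = λ { refl _ → refl } }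
          ; homo = constₚ-+
          }
        ; ε-homo = constₚ-0
        }
      ; *-homo = constₚ-*
      }
    ; 1#-homo = λ _ → refl
    }
  ; -‿homo = λ { _ zero → refl ; _ (suc n) → refl }
  }

open ℚ-Algebra ℚ[x] constₚ constₚ-isRingHomomorphism
open GammaCone xₚ
open Mult P.semiring using () renaming (_×_ to _·ₚ_)
open SeriesCalculus ℚ[x] using (D; inverse-integral-ode)

-- The differential equation of sn.

sn-0 : sn 0 ≈ₚ []
sn-0 _ = refl

sn-1 : sn 1 ≈ₚ 1ₚ
sn-1 zero    = refl
sn-1 (suc n) = refl

sn-ode : ∀ n → D (D sn) n ≈ₚ -ₚ y *ₚ sn n +ₚ (xₚ +ₚ xₚ) *ₚ (sn ⊛ (sn ⊛ sn)) n
sn-ode n = double-injective {D (D sn) n} { -ₚ y *ₚ sn n +ₚ (xₚ +ₚ xₚ) *ₚ (sn ⊛ (sn ⊛ sn)) n}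
  (inverse-integral-ode xₚ {ellipticIntegral} {sqrt (constₚ ½) radicand} {sn}
    sn-0 sn-spec √radicand-D sqrt-radicand-spec n)
  where
  D-ellipticIntegral : D ellipticIntegral ≋ integrand
  D-ellipticIntegral n = ·-unit-fraction n (integrand n)

  √radicand-D : sqrt (constₚ ½) radicand ⊛ D ellipticIntegral ≋ const 1ₚ
  √radicand-D n = P.trans
    {(sqrt (constₚ ½) radicand ⊛ D ellipticIntegral) n} {(sqrt (constₚ ½) radicand ⊛ integrand) n} {const 1ₚ n}
    (⊛-cong {sqrt (constₚ ½) radicand} {sqrt (constₚ ½) radicand} {D ellipticIntegral} {integrand}
      (λ _ _ → refl) D-ellipticIntegral n)
    (integrand-spec n)

module sn-Solution = Solution {sn} sn-0 sn-1 sn-ode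

-- Symmetric unimodal coefficient sequences.

-- The range i ≤ j ≤ m - i in increasing, rather than i ≤ j ≤ m / 2, is what makes the step
-- from f to (1 + x) f immediate: it compares f i with f (j - 1) and f (i - 1) with f j.
record Mountain (m : ℕ) (f : ℕ → ℚ) : Set where
  field
    nonNegative : ∀ i → 0ℚ ℚ.≤ f i
    vanishes    : ∀ {i} → m ℕ.< i → f i ≡ 0ℚ
    symmetric   : ∀ {i j} → i ℕ.+ j ≡ m → f i ≡ f j
    increasing  : ∀ {i j} → i ℕ.≤ j → i ℕ.+ j ℕ.≤ m → f i ℚ.≤ f j

open Mountain

mountain-resp : ∀ {m f g} → (∀ i → f i ≡ g i) → Mountain m f → Mountain m g
mountain-resp f≗g F = record
  { nonNegative = λ i → ≡.subst (0ℚ ℚ.≤_) (f≗g i) (nonNegative F i)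
  ; vanishes    = λ {i} m<i → ≡.trans (≡.sym (f≗g i)) (vanishes F m<i)
  ; symmetric   = λ {i} {j} e → ≡.trans (≡.sym (f≗g i)) (≡.trans (symmetric F e) (f≗g j))
  ; increasing  = λ {i} {j} i≤j i+j≤m → ≡.subst₂ ℚ._≤_ (f≗g i) (f≗g j) (increasing F i≤j i+j≤m)
  }

mountain-0 : ∀ m → Mountain m (λ _ → 0ℚ)
mountain-0 m = record
  { nonNegative = λ _ → ℚ.≤-refl
  ; vanishes    = λ _ → refl
  ; symmetric   = λ _ → refl
  ; increasing  = λ _ _ → ℚ.≤-refl
  }

mountain-+ : ∀ {m f g} → Mountain m f → Mountain m g → Mountain m (λ i → f i ℚ.+ g i)
mountain-+ F G = record
  { nonNegative = λ i → ℚ.+-mono-≤ (nonNegative F i) (nonNegative G i)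
  ; vanishes    = λ m<i → ≡.cong₂ ℚ._+_ (vanishes F m<i) (vanishes G m<i)
  ; symmetric   = λ e → ≡.cong₂ ℚ._+_ (symmetric F e) (symmetric G e)
  ; increasing  = λ i≤j i+j≤m → ℚ.+-mono-≤ (increasing F i≤j i+j≤m) (increasing G i≤j i+j≤m)
  }

mountain-* : ∀ {m a f} → 0ℚ ℚ.≤ a → Mountain m f → Mountain m (λ i → a ℚ.* f i)
mountain-* {a = a} 0≤a F = record
  { nonNegative = λ i → 0≤a*b 0≤a (nonNegative F i)
  ; vanishes    = λ m<i → ≡.trans (≡.cong (a ℚ.*_) (vanishes F m<i)) (ℚ.*-zeroʳ a)
  ; symmetric   = λ e → ≡.cong (a ℚ.*_) (symmetric F e)
  ; increasing  = λ i≤j i+j≤m → ℚ.*-monoˡ-≤-nonNeg a {{ℚ.nonNegative 0≤a}} (increasing F i≤j i+j≤m)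
  }

mountain-1 : Mountain 0 (ℚ⟦x⟧.const 1ℚ)
mountain-1 = record
  { nonNegative = λ { zero → 0≤fraction 1 0 ; (suc _) → ℚ.≤-refl }
  ; vanishes    = λ { (s≤s _) → refl }
  ; symmetric   = λ { {zero} {zero} _ → refl }
  ; increasing  = λ { {zero} {zero} _ _ → ℚ.≤-refl }
  }

-- Multiplication by x moves the centre m/2 up by one, so `m`, which is twice the centre and not
-- always the degree, grows by two. The new end coefficients, at 0 and m + 2, are both zero.
mountain-shift : ∀ {m f} → Mountain m f → Mountain (2 ℕ.+ m) (ℚ⟦x⟧.shift f)
mountain-shift {m} {f} F = record
  { nonNegative = λ { zero → ℚ.≤-refl ; (suc i) → nonNegative F i }
  ; vanishes    = λ { (s≤s 2+m≤i) → vanishes F (ℕ.<⇒≤ 2+m≤i) }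
  ; symmetric   = λ {i} {j} → sym′ i j
  ; increasing  = inc
  }
  where
  sym′ : ∀ i j → i ℕ.+ j ≡ 2 ℕ.+ m → ℚ⟦x⟧.shift f i ≡ ℚ⟦x⟧.shift f j
  sym′ zero    (suc .(suc m)) refl = ≡.sym (vanishes F ℕ.≤-refl)
  sym′ (suc i) zero e = vanishes F (ℕ.≤-reflexive (ℕ.suc-injective (≡.trans (≡.sym e) (ℕ.+-identityʳ (suc i)))))
  sym′ (suc i) (suc j) e = symmetric F
    (ℕ.suc-injective (≡.trans (≡.sym (ℕ.+-suc i j)) (ℕ.suc-injective e)))

  inc : ∀ {i j} → i ℕ.≤ j → i ℕ.+ j ℕ.≤ 2 ℕ.+ m → ℚ⟦x⟧.shift f i ℚ.≤ ℚ⟦x⟧.shift f j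
  inc {zero}  {zero}  _         _ = ℚ.≤-refl
  inc {zero}  {suc j} _         _ = nonNegative F j
  inc {suc i} {suc j} (s≤s i≤j) (s≤s h) =
    increasing F i≤j (ℕ.s≤s⁻¹ (≡.subst (ℕ._≤ suc m) (ℕ.+-suc i j) h))

mountain-1+x : ∀ {m f} → Mountain m f → Mountain (suc m) (λ i → f i ℚ.+ ℚ⟦x⟧.shift f i)
mountain-1+x {m} {f} F = record
  { nonNegative = λ
      { zero    → ℚ.+-mono-≤ (nonNegative F 0) (ℚ.≤-refl {0ℚ})
      ; (suc i) → ℚ.+-mono-≤ (nonNegative F (suc i)) (nonNegative F i)
      }
  ; vanishes    = λ { (s≤s m<i) → ≡.cong₂ ℚ._+_ (vanishes F (ℕ.m<n⇒m<1+n m<i)) (vanishes F m<i) }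
  ; symmetric   = λ {i} {j} → sym′ i j
  ; increasing  = inc
  }
  where
  g : ℕ → ℚ
  g i = f i ℚ.+ ℚ⟦x⟧.shift f i

  sym₀ : g 0 ≡ g (suc m)
  sym₀ = ≡.trans (ℚ.+-comm (f 0) 0ℚ) (≡.cong₂ ℚ._+_ (≡.sym (vanishes F ℕ.≤-refl)) (symmetric F refl))

  sym′ : ∀ i j → i ℕ.+ j ≡ suc m → g i ≡ g j
  sym′ zero    .(suc m) refl = sym₀
  sym′ (suc i) zero     e    = ≡.sym (≡.trans sym₀ (≡.cong g (≡.trans (≡.sym e) (ℕ.+-identityʳ (suc i)))))
  -- Reflection exchanges the two summands of `g`, hence the commutation.
  sym′ (suc i) (suc j)  e    = ≡.trans (ℚ.+-comm (f (suc i)) (f i)) (≡.cong₂ ℚ._+_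
    (symmetric F (ℕ.suc-injective e))
    (symmetric F (ℕ.suc-injective (≡.trans (≡.sym (≡.cong suc (ℕ.+-suc i j))) e))))

  inc : ∀ {i j} → i ℕ.≤ j → i ℕ.+ j ℕ.≤ suc m → g i ℚ.≤ g j
  -- Comparing f i with f (j - 1) requires i < j, so the case i = j is split off.
  inc {i} {j} i≤j h with ℕ.m≤n⇒m<n∨m≡n i≤j
  ... | inj₂ refl = ℚ.≤-refl
  inc {zero}  {suc j} _ (s≤s h) | inj₁ _ = ≡.subst (ℚ._≤ g (suc j)) (ℚ.+-comm 0ℚ (f 0))
    (ℚ.+-mono-≤ (nonNegative F (suc j)) (increasing F z≤n h))
  inc {suc i} {suc j} _ (s≤s h) | inj₁ (s≤s i<j) = ≡.subst (ℚ._≤ g (suc j)) (ℚ.+-comm (f i) (f (suc i)))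
    (ℚ.+-mono-≤ (increasing F (ℕ.≤-trans (ℕ.n≤1+n i) (ℕ.m≤n⇒m≤1+n i<j)) h)
      (increasing F i<j (≡.subst (ℕ._≤ m) (ℕ.+-suc i j) h)))

mountain-[1+x]^ : ∀ l → Mountain l (coeff (y ^ₚ l))
mountain-[1+x]^ zero    = mountain-resp (λ i → ≡.sym (coeff-constₚ 1ℚ i)) mountain-1
mountain-[1+x]^ (suc l) = mountain-resp (λ i → ≡.sym (coeff-1+xₚ-* (y ^ₚ l) i)) (mountain-1+x (mountain-[1+x]^ l))

mountain-x^* : ∀ {m} k p → Mountain m (coeff p) → Mountain (m ℕ.+ 2 ℕ.* k) (coeff (xₚ ^ₚ k *ₚ p))
mountain-x^* {m} zero    p F = ≡.subst (λ n → Mountain n _) (≡.sym (ℕ.+-identityʳ m))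
  (mountain-resp (λ i → ≡.sym (P.*-identityˡ p i)) F)
mountain-x^* {m} (suc k) p F = ≡.subst (λ n → Mountain n (coeff (xₚ ^ₚ suc k *ₚ p))) weight
  (mountain-resp (λ i → ≡.trans (≡.sym (coeff-xₚ-* (xₚ ^ₚ k *ₚ p) i)) (≡.sym (P.*-assoc xₚ (xₚ ^ₚ k) p i)))
    (mountain-shift (mountain-x^* k p F)))
  where
  weight : 2 ℕ.+ (m ℕ.+ 2 ℕ.* k) ≡ m ℕ.+ 2 ℕ.* suc k
  weight = ≡.trans (≡.sym (ℕ.+-assoc 2 m (2 ℕ.* k))) (≡.trans (≡.cong (ℕ._+ 2 ℕ.* k) (ℕ.+-comm 2 m))
    (≡.trans (ℕ.+-assoc m 2 (2 ℕ.* k)) (≡.cong (m ℕ.+_) (≡.sym (ℕ.*-suc 2 k)))))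

mountain-γ-term : ∀ m γ k → 0ℚ ℚ.≤ γ k → Mountain m (coeff (γ-term m γ k))
mountain-γ-term m γ k 0≤γk = ≡.subst (λ n → Mountain n (coeff (γ-term m γ k))) (ℕ.m∸n+n≡m 2k≤m)
  (mountain-resp (λ i → ≡.trans (≡.sym (coeff-constₚ-* (γ k) (xₚ ^ₚ toℕ k *ₚ y ^ₚ l) i))
      (≡.sym (P.*-assoc (constₚ (γ k)) (xₚ ^ₚ toℕ k) (y ^ₚ l) i)))
    (mountain-* 0≤γk (mountain-x^* (toℕ k) (y ^ₚ l) (mountain-[1+x]^ l))))
  where
  l = m ∸ 2 ℕ.* toℕ k

  -- Makes the truncated subtraction in `l` exact, so that all terms share the same centre m/2.
  2k≤m : 2 ℕ.* toℕ k ℕ.≤ m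
  2k≤m = ℕ.≤-trans (ℕ.*-monoʳ-≤ 2 (Fin.toℕ≤pred[n] k)) (ℕ.≤-trans
    (ℕ.+-monoʳ-≤ ⌊ m /2⌋ (ℕ.≤-trans (ℕ.≤-reflexive (ℕ.+-identityʳ ⌊ m /2⌋)) (ℕ.⌊n/2⌋≤⌈n/2⌉ m)))
    (ℕ.≤-reflexive (ℕ.⌊n/2⌋+⌈n/2⌉≡n m)))

mountain-sum : ∀ {m n} (t : Fin n → Poly) → (∀ k → Mountain m (coeff (t k))) → Mountain m (coeff (sumₚ t))
mountain-sum {m} {zero}  t T = mountain-0 m
mountain-sum {m} {suc n} t T = mountain-resp (λ i → ≡.sym (coeff-+ (t zero) (sumₚ (λ k → t (suc k))) i))
  (mountain-+ (T zero) (mountain-sum (λ k → t (suc k)) (λ k → T (suc k))))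

expansion⇒mountain : ∀ {m} p → GammaExpansion m p → Mountain m (coeff p)
expansion⇒mountain {m} p (γ , p≈ , 0≤γ) = mountain-resp (λ i → ≡.sym (p≈ i))
  (mountain-sum (γ-term m γ) (λ k → mountain-γ-term m γ k (0≤γ k)))

mountain⇒symmetric : ∀ {m} p → Mountain m (coeff p) → Symmetric m p
mountain⇒symmetric p F i i≤m = symmetric F (ℕ.m+[n∸m]≡n i≤m)

mountain⇒unimodal : ∀ {m} p → Mountain m (coeff p) → Unimodal m p
mountain⇒unimodal {m} p F = r , ℕ.⌊n/2⌋≤n m , up , down
  where
  r = ⌊ m /2⌋

  up : ∀ i → i ℕ.< r → coeff p i ℚ.≤ coeff p (suc i)
  up i i<r = increasing F (ℕ.n≤1+n i) (ℕ.≤-trans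
    (ℕ.+-mono-≤ (ℕ.<⇒≤ i<r) (ℕ.≤-trans i<r (ℕ.⌊n/2⌋≤⌈n/2⌉ m))) (ℕ.≤-reflexive (ℕ.⌊n/2⌋+⌈n/2⌉≡n m)))

  down : ∀ i → r ℕ.≤ i → i ℕ.< m → coeff p (suc i) ℚ.≤ coeff p i
  -- Both indices are reflected into the increasing half; there the condition on their sum amounts
  -- to `m∸i≤1+i`.
  down i r≤i i<m = ≡.subst₂ ℚ._≤_ (symmetric F (ℕ.m∸n+n≡m i<m)) (symmetric F (ℕ.m∸n+n≡m (ℕ.<⇒≤ i<m)))
    (increasing F (ℕ.∸-monoʳ-≤ m (ℕ.n≤1+n i)) (ℕ.≤-trans
      (ℕ.+-monoʳ-≤ (m ∸ suc i) m∸i≤1+i) (ℕ.≤-reflexive (ℕ.m∸n+n≡m i<m))))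
    where
    ⌈n/2⌉≤1+⌊n/2⌋ : ∀ n → ℕ.⌈ n /2⌉ ℕ.≤ suc ⌊ n /2⌋
    ⌈n/2⌉≤1+⌊n/2⌋ zero          = z≤n
    ⌈n/2⌉≤1+⌊n/2⌋ (suc zero)    = s≤s z≤n
    ⌈n/2⌉≤1+⌊n/2⌋ (suc (suc n)) = s≤s (⌈n/2⌉≤1+⌊n/2⌋ n)

    m∸i≤1+i : m ∸ i ℕ.≤ suc i
    m∸i≤1+i = ℕ.≤-trans (ℕ.∸-monoʳ-≤ m r≤i) (ℕ.≤-trans
      (ℕ.≤-reflexive (≡.trans (≡.cong (_∸ r) (≡.sym (ℕ.⌊n/2⌋+⌈n/2⌉≡n m))) (ℕ.m+n∸m≡n r ℕ.⌈ m /2⌉)))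
      (ℕ.≤-trans (⌈n/2⌉≤1+⌊n/2⌋ m) (s≤s r≤i)))

-- Nonvanishing of the constant term.

coeff-0-· : ∀ j p → coeff p 0 ≡ 0ℚ → coeff (j ·ₚ p) 0 ≡ 0ℚ
coeff-0-· zero    p p0 = refl
coeff-0-· (suc j) p p0 = ≡.trans (coeff-+ p (j ·ₚ p) 0) (≡.cong₂ ℚ._+_ p0 (coeff-0-· j p p0))

-- Evaluated at x = 0, the differential equation for sn is the one for sin.
ode-at-0 : ∀ j k p q c → j ·ₚ (k ·ₚ q) ≈ₚ -ₚ y *ₚ p +ₚ (xₚ +ₚ xₚ) *ₚ c → coeff q 0 ≡ 0ℚ → coeff p 0 ≡ 0ℚ
ode-at-0 j k p q c ode q0 = ℚP.-‿injective {x = v} {y = 0ℚ} (begin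
  ℚ.- v                                                  ≡⟨ ≡.cong ℚ.-_ (ℚ.*-identityˡ v) ⟨
  ℚ.- (1ℚ ℚ.* v)                                         ≡⟨ ℚ.neg-distribˡ-* 1ℚ v ⟩
  ℚ.- 1ℚ ℚ.* v                                           ≡⟨ ℚ.+-identityʳ (ℚ.- 1ℚ ℚ.* v) ⟨
  ℚ.- 1ℚ ℚ.* v ℚ.+ 0ℚ                                    ≡⟨ ≡.cong (ℚ.- 1ℚ ℚ.* v ℚ.+_) (ℚ.*-zeroˡ (coeff c 0)) ⟨
  ℚ.- 1ℚ ℚ.* v ℚ.+ 0ℚ ℚ.* coeff c 0                      ≡⟨ ≡.cong₂ ℚ._+_ (coeff-* (-ₚ y) p 0) (coeff-* (xₚ +ₚ xₚ) c 0) ⟨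
  coeff (-ₚ y *ₚ p) 0 ℚ.+ coeff ((xₚ +ₚ xₚ) *ₚ c) 0      ≡⟨ coeff-+ (-ₚ y *ₚ p) ((xₚ +ₚ xₚ) *ₚ c) 0 ⟨
  coeff (-ₚ y *ₚ p +ₚ (xₚ +ₚ xₚ) *ₚ c) 0                 ≡⟨ ode 0 ⟨
  coeff (j ·ₚ (k ·ₚ q)) 0                                ≡⟨ coeff-0-· j (k ·ₚ q) (coeff-0-· k q q0) ⟩
  0ℚ                                                     ∎)
  where
  open ≡.≡-Reasoning
  v = coeff p 0

-- Descent: a zero at index 2n + 3 would force one at 2n + 1, and so on down to `sn 1`, whose
-- constant term is 1.
sn-coeff-0 : ∀ n → coeff (sn (suc (2 ℕ.* n))) 0 ≢ 0ℚ
sn-coeff-0 zero    ()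
sn-coeff-0 (suc n) e = sn-coeff-0 n (ode-at-0
  (2 ℕ.+ m) (3 ℕ.+ m) (sn (1 ℕ.+ m)) (sn (3 ℕ.+ m)) ((sn ⊛ (sn ⊛ sn)) (1 ℕ.+ m))
  (sn-ode (1 ℕ.+ m)) (≡.subst (λ i → coeff (sn (suc i)) 0 ≡ 0ℚ) (ℕ.*-suc 2 n) e))
  where m = 2 ℕ.* n

-- From the coefficients of sn to `J`.

neg-/1 : ∀ i → (ℤ.- i) ℚ./ 1 ≡ ℚ.- (i ℚ./ 1)
neg-/1 (ℤ.+ zero)  = refl
neg-/1 (ℤ.+ suc n) = refl
neg-/1 ℤ.-[1+ n ]  = ≡.sym (ℚP.-‿involutive (ℤ.+ suc n ℚ./ 1))

sgn-/1 : ∀ n i → ((ℤ.-1ℤ ℤ.^ n) ℤ.* i) ℚ./ 1 ≡ sgn n ℚ.* (i ℚ./ 1)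
sgn-/1 zero    i = ≡.trans (≡.cong (ℚ._/ 1) (ℤ.*-identityˡ i)) (≡.sym (ℚ.*-identityˡ (i ℚ./ 1)))
sgn-/1 (suc n) i = begin
  (ℤ.-1ℤ ℤ.* ℤ.-1ℤ ℤ.^ n ℤ.* i) ℚ./ 1      ≡⟨ ≡.cong (ℚ._/ 1) (ℤ.*-assoc ℤ.-1ℤ (ℤ.-1ℤ ℤ.^ n) i) ⟩
  (ℤ.-1ℤ ℤ.* (ℤ.-1ℤ ℤ.^ n ℤ.* i)) ℚ./ 1    ≡⟨ ≡.cong (ℚ._/ 1) (ℤ.-1*i≡-i (ℤ.-1ℤ ℤ.^ n ℤ.* i)) ⟩
  (ℤ.- (ℤ.-1ℤ ℤ.^ n ℤ.* i)) ℚ./ 1          ≡⟨ neg-/1 (ℤ.-1ℤ ℤ.^ n ℤ.* i) ⟩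
  ℚ.- ((ℤ.-1ℤ ℤ.^ n ℤ.* i) ℚ./ 1)          ≡⟨ ≡.cong ℚ.-_ (sgn-/1 n i) ⟩
  ℚ.- (sgn n ℚ.* (i ℚ./ 1))                ≡⟨ ℚ.neg-distribˡ-* (sgn n) (i ℚ./ 1) ⟩
  sgn (suc n) ℚ.* (i ℚ./ 1)                ∎
  where open ≡.≡-Reasoning

sgn≢0 : ∀ n → sgn n ≢ 0ℚ
sgn≢0 n e with () ← ≡.trans (≡.sym (≡.cong (λ s → s ℚ.* s) e)) (sgn*sgn n)

!/1≢0 : ∀ n → ℤ.+ (n !) ℚ./ 1 ≢ 0ℚ
!/1≢0 n e = ℚ.<⇒≢ (ℚ.positive⁻¹ (ℤ.+ (n !) ℚ./ 1) {{ℚ.normalize-pos (n !) 1 {{_}} {{n ℕ.!≢0}}}}) (≡.sym e)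

J-scale : ∀ n → J n ≡ constₚ (sgn n ℚ.* (ℤ.+ ((1 ℕ.+ 2 ℕ.* n) !) ℚ./ 1)) *ₚ sn (1 ℕ.+ 2 ℕ.* n)
J-scale n = ≡.cong (λ a → constₚ a *ₚ sn (1 ℕ.+ 2 ℕ.* n)) (sgn-/1 n (ℤ.+ ((1 ℕ.+ 2 ℕ.* n) !)))

J-expansion : ∀ n → GammaExpansion n (J n)
J-expansion n = ≡.subst (GammaExpansion n) (≡.sym (J-scale n))
  (cone⇒expansion n (0≤fraction ((1 ℕ.+ 2 ℕ.* n) !) 0) (sn-Solution.cone-tail (2 ℕ.* n)))

J-coeff-0 : ∀ n → coeff (J n) 0 ≢ 0ℚ
J-coeff-0 n e = x#0y#0→xy#0 (x#0y#0→xy#0 (sgn≢0 n) (!/1≢0 (1 ℕ.+ 2 ℕ.* n))) (sn-coeff-0 n)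
  (≡.trans (≡.sym (coeff-constₚ-* (sgn n ℚ.* (ℤ.+ ((1 ℕ.+ 2 ℕ.* n) !) ℚ./ 1)) (sn (1 ℕ.+ 2 ℕ.* n)) 0))
    (≡.trans (≡.sym (≡.cong (λ p → coeff p 0) (J-scale n))) e))

theorem3 : ∀ (n : ℕ) → HasDegree n (J n) × GammaPositive n (J n) × Symmetric n (J n) × Unimodal n (J n)
theorem3 n =
    -- Symmetry at the pair (0, n) identifies the leading coefficient with the constant term.
    ((λ Jₙ≡0 → J-coeff-0 n (≡.trans (symmetric mountain refl) Jₙ≡0)) , λ i → vanishes mountain)
  , (mountain⇒symmetric (J n) mountain , J-expansion n)
  , mountain⇒symmetric (J n) mountain
  , mountain⇒unimodal (J n) mountain
  where
  mountain : Mountain n (coeff (J n))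
  mountain = expansion⇒mountain (J n) (J-expansion n)
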